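{- For each integer $n\ge 0$, let $a_n$ denote the number of tilings of a $9\times 8n$ board by $L$-tetrominoes (rotations allowed, reflections not allowed). Then the generating function is $\sum_{n\ge 0}a_nt^n=-A(t)/B(t)$, where both $A(t)$ and $B(t)$ are polynomials of degree $146$. The first terms of the sequence $(a_n)_{n\ge 0}$ are \[1, 114, 42305, 17416144, 7258193991, 3032714594518, 1267783654718834, \ldots \]
   Context: A $k\times n$ board is the rectangle of unit cells $\{(x,y)\in\mathbb{Z}^2: 0\le x<n,\ 0\le y<k\}$, where each cell is named by its bottom left corner. The $L$-tetromino tiles are the translates of the four sets (the rotations of the $L$-tetromino) \[\{(0,0),(0,1),(0,2),(1,0)\},\ \{(0,0),(0,1),(1,1),(2,1)\},\ \{(0,0),(1,0),(2,0),(2,1)\},\ \{(0,2),(1,0),(1,1),(1,2)\}.\] Reflections of these shapes are not allowed. A tiling of a board is a partition of its set of cells into such tiles (each tile may be used any number of times); two tilings are the same only if they are equal as partitions of the board (no identification under symmetries). The empty board ($n=0$) has exactly one tiling. Generating functions are formal power series in $t$ with rational coefficients, and polynomials are polynomials in $t$ with rational coefficients. The polynomials $A$ and $B$ are not specified explicitly; the assertion is that such polynomials exist. -}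

module Defs where

open import Data.Integer using (+_)
open import Data.List using (List; []; _∷_; _++_; map; filter; length; upTo; cartesianProduct; cartesianProductWith)
open import Data.List.Relation.Unary.All using (All; all?)
open import Data.List.Relation.Unary.AllPairs using (AllPairs; allPairs?)
open import Data.List.Relation.Unary.Any using (Any; any?)
open import Data.Nat using (ℕ; suc; _+_; _∸_; _<_)
import Data.Nat.Properties as ℕ
open import Data.Fin using (toℕ)
open import Data.Product using (_×_; _,_)
open import Data.Product.Properties using (≡-dec)
open import Data.Rational using (ℚ; 0ℚ; _/_; -_; +-0-rawMonoid) renaming (_*_ to _*ℚ_)
open import Algebra.Definitions.RawMonoid +-0-rawMonoid using (sum)
open import Relation.Binary.Definitions using (DecidableEquality; Decidable)
open import Relation.Binary.PropositionalEquality using (_≡_; _≢_)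
open import Relation.Nullary.Decidable using (_×-dec_; ¬?)
import Relation.Unary as U
import Data.List.Membership.DecPropositional as DecMembership

-- Coordinates (x , y), x horizontal.  The cells of a board have natural number
-- coordinates, so ℕ × ℕ suffices in place of ℤ × ℤ.
Cell : Set
Cell = ℕ × ℕ

_≟_ : DecidableEquality Cell
_≟_ = ≡-dec ℕ._≟_ ℕ._≟_

open DecMembership _≟_ public using (_∈_; _∉_; _∈?_; _∉?_)

board : (k n : ℕ) → List Cell
board k n = cartesianProduct (upTo n) (upTo k)

shapes : List (List Cell)
shapes = ((0 , 0) ∷ (0 , 1) ∷ (0 , 2) ∷ (1 , 0) ∷ [])
       ∷ ((0 , 0) ∷ (0 , 1) ∷ (1 , 1) ∷ (2 , 1) ∷ [])
       ∷ ((0 , 0) ∷ (1 , 0) ∷ (2 , 0) ∷ (2 , 1) ∷ [])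
       ∷ ((0 , 2) ∷ (1 , 0) ∷ (1 , 1) ∷ (1 , 2) ∷ [])
       ∷ []

translate : Cell → List Cell → List Cell
translate (u , v) = map λ (x , y) → (u + x , v + y)

-- All tiles contained in the k × n board, each listed exactly once.  The least
-- x- and the least y-coordinate of every shape are 0, so the translation vector
-- of a tile contained in the board is itself a cell of the board.
tiles : (k n : ℕ) → List (List Cell)
tiles k n =
  filter (all? (_∈? board k n)) (cartesianProductWith translate (board k n) shapes)

Disjoint : List Cell → List Cell → Set
Disjoint s t = All (_∉ t) s

IsTiling : (k n : ℕ) → List (List Cell) → Set
IsTiling k n T = AllPairs Disjoint T × All (λ c → Any (c ∈_) T) (board k n)

disjoint? : Decidable Disjoint
disjoint? s t = all? (_∉? t) s

isTiling? : (k n : ℕ) → U.Decidable (IsTiling k n)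
isTiling? k n T =
  allPairs? disjoint? T ×-dec all? (λ c → any? (c ∈?_) T) (board k n)

-- When the entries of xs are distinct, every set of entries of xs occurs in
-- sublists xs exactly once, in the order inherited from xs.
sublists : ∀ {a} {A : Set a} → List A → List (List A)
sublists []       = [] ∷ []
sublists (x ∷ xs) = sublists xs ++ map (x ∷_) (sublists xs)

tilings : (k n : ℕ) → List (List (List Cell))
tilings k n = filter (isTiling? k n) (sublists (tiles k n))

numTilings : (k n : ℕ) → ℕ
numTilings k n = length (tilings k n)

-- The coefficient sequence of a formal power series in t over ℚ.
PowerSeries : Set
PowerSeries = ℕ → ℚ

-- P is a polynomial of degree d.
HasDegree : PowerSeries → ℕ → Set
HasDegree P d = P d ≢ 0ℚ × (∀ i → d < i → P i ≡ 0ℚ)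

neg : PowerSeries → PowerSeries
neg F n = - F n

_⊛_ : PowerSeries → PowerSeries → PowerSeries
(F ⊛ G) n = sum {suc n} λ i → F (toℕ i) *ℚ G (n ∸ toℕ i)

-- F = P / Q in ℚ[[t]], where Q is invertible exactly when Q 0 ≢ 0ℚ.
_IsQuotientOf_By_ : PowerSeries → PowerSeries → PowerSeries → Set
F IsQuotientOf P By Q = Q 0 ≢ 0ℚ × (∀ n → (Q ⊛ F) n ≡ P n)

generatingFunction : (ℕ → ℕ) → PowerSeries
generatingFunction a n = + a n / 1

{-# OPTIONS --safe #-}

-- Go through the possible tiles in the order of their translation vectors and
-- decide for each whether it is used.  The cells before the current one can no
-- longer be covered later, so the number of completions depends only on which of
-- the cells of the current and the next two columns are covered: it is obtained
-- from the indicator of the empty window by one linear operator per column.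
-- Let f j be the number of completions, as a function of the window, when 8 j
-- columns are left.  The windows reachable from the empty one after 16 columns
-- form a set R of 693 windows closed under eight further columns, so that f j on
-- R determines f (j + 1) on R.  The coefficients B i of the denominator satisfy
-- Σ B i f (148 - i) = 0 on R, by computation; applying the operator again gives
-- the recurrence for all later terms at the empty window.
--
-- To make the computation cheap, a function on R is stored as the list of its
-- digits in a large base X.  The adjoint of the operator is applied just once, to
-- the multiset in which the i-th window of R has multiplicity X ^ i; the pairing
-- of the result with f j is then the number with digits f (j + 1).
module Submission where

open import Defs
open import Data.Bool using (Bool; true; false; if_then_else_; _∧_; _∨_; not; T)
open import Data.Bool.Properties using (∨-zeroʳ; T-∧; T-≡; T-not-≡)
open import Data.Fin using (Fin; toℕ)
open import Data.Integer using (ℤ; +_; -[1+_]; _⊖_; 0ℤ) renaming (-_ to -ℤ_; _*_ to _*ℤ_; _+_ to _+ℤ_)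
import Data.Integer.Properties as ℤ
open import Data.List
  using (List; []; _∷_; _++_; map; filter; length; upTo; applyUpTo; downFrom; iterate; zipWith; head; drop
        ; cartesianProduct; cartesianProductWith)
open import Data.List.Membership.Propositional using (find)
open import Data.List.Membership.Propositional.Properties
  using (∈-cartesianProduct⁺; ∈-cartesianProduct⁻; ∈-cartesianProductWith⁻; ∈-upTo⁺; ∈-upTo⁻
        ; ∈-map⁺; ∈-map⁻; ∈-++⁺ˡ; ∈-++⁺ʳ; ∈-++⁻)
open import Data.List.Properties
  using (filter-++; filter-≐; filter-none; filter-accept; filter-reject; length-++; map-∘; map-cong
        ; ++-assoc; ++-identityʳ; ∷-injective)
open import Data.List.Relation.Unary.All as All using (All; []; _∷_; all?)
import Data.List.Relation.Unary.All.Properties as All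
open import Data.List.Relation.Unary.AllPairs using (AllPairs; []; _∷_; allPairs?)
open import Data.List.Relation.Unary.Any using (Any; here; there; any?)
open import Data.Maybe using (fromMaybe)
open import Data.Nat
  using (ℕ; zero; suc; _+_; _*_; _∸_; _^_; _/_; _%_; ∣_-_∣; _≤_; _<_; z≤n; s≤s; _≤?_; _<?_; _≡ᵇ_; _<ᵇ_)
open import Data.Nat.Divisibility using (divides-refl)
open import Data.Nat.DivMod using ([m+kn]%n≡m%n; m<n⇒m%n≡m; +-distrib-/-∣ʳ; m<n⇒m/n≡0; m*n/n≡m)
import Data.Nat.Properties as ℕ
open import Data.Product using (_×_; _,_; proj₁; proj₂; ∃-syntax; uncurry)
open import Data.Rational as ℚ using (ℚ; 0ℚ; toℚᵘ)
import Data.Rational.Properties as ℚ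
open import Data.Rational.Unnormalised as ℚᵘ using (mkℚᵘ; *≡*)
import Data.Rational.Unnormalised.Properties as ℚᵘ
open import Data.Sum using (_⊎_; inj₁; inj₂; [_,_]′)
open import Data.Vec using (Vec; []; _∷_; tabulate; replicate) renaming (_++_ to _++ᵛ_; zipWith to zipWithᵛ)
open import Function using (_∘_; id; _$_)
open import Function.Bundles using (Equivalence)
open import Relation.Binary.Definitions using (tri<; tri≈; tri>)
open import Relation.Binary.PropositionalEquality
  using (_≡_; _≢_; refl; sym; trans; cong; cong₂; subst; module ≡-Reasoning)
open import Relation.Nullary using (Dec; yes; no; does; ¬_; contradiction)
open import Relation.Nullary.Decidable using (dec-true; dec-false; from-yes; _×-dec_; _⊎-dec_)
import Relation.Unary as U
open import Algebra.Definitions.RawMonoid ℚ.+-0-rawMonoid using (sum)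
open import Algebra.Properties.CommutativeSemigroup ℕ.+-commutativeSemigroup using () renaming (interchange to +-interchange)
open import Algebra.Properties.CommutativeSemigroup ℤ.+-commutativeSemigroup using () renaming (interchange to ℤ-interchange)
open import Algebra.Properties.Group ℚ.+-0-group using (⁻¹-involutive)
open import Data.List.Membership.DecPropositional ℕ._≟_ using () renaming (_∈?_ to _∈ℕ?_)

-- Exact covers by recursion over the list of tiles

length-filter-map : ∀ {A B : Set} {P : B → Set} (P? : U.Decidable P) (f : A → B) xs →
  length (filter P? (map f xs)) ≡ length (filter (P? ∘ f) xs)
length-filter-map P? f []       = refl
length-filter-map P? f (x ∷ xs) with does (P? (f x))
... | true  = cong suc (length-filter-map P? f xs)
... | false = length-filter-map P? f xs

-- Relative form of `IsTiling`: the cells `C` covered so far let the induction over `sublists` move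
-- a chosen tile from `T` into `C`.
Completes : List Cell → List Cell → List (List Cell) → Set
Completes B C T = AllPairs Disjoint T × All (Disjoint C) T × All (λ c → c ∈ C ⊎ Any (c ∈_) T) B

completes? : ∀ B C → U.Decidable (Completes B C)
completes? B C T =
  allPairs? disjoint? T ×-dec all? (disjoint? C) T ×-dec all? (λ c → (c ∈? C) ⊎-dec any? (c ∈?_) T) B

module _ (k n : ℕ) where

  fitsBoard? : U.Decidable (All (_∈ board k n))
  fitsBoard? = all? (_∈? board k n)

  -- Opaque, like the operators on windows below, because conversion checking
  -- would otherwise unfold it into exponentially many cases.
  opaque
    exactCovers : List Cell → List (List Cell) → ℕ
    exactCovers C []      = if does (all? (_∈? C) (board k n)) then 1 else 0
    exactCovers C (t ∷ L) =
      exactCovers C L +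
      (if does (fitsBoard? t) ∧ does (disjoint? C t) then exactCovers (t ++ C) L else 0)

  completes-∷⁺ : ∀ {C t T} → Disjoint C t → Completes (board k n) (t ++ C) T → Completes (board k n) C (t ∷ T)
  completes-∷⁺ {t = t} C#t (T# , tC#T , cov) =
      All.map (All.++⁻ˡ t) tC#T ∷ T#
    , C#t ∷ All.map (All.++⁻ʳ t) tC#T
    , All.map [ (λ c∈ → [ inj₂ ∘ here , inj₁ ]′ (∈-++⁻ t c∈)) , inj₂ ∘ there ]′ cov

  completes-∷⁻ : ∀ {C t T} → Completes (board k n) C (t ∷ T) → Completes (board k n) (t ++ C) T
  completes-∷⁻ {t = t} (t#T ∷ T# , C#t ∷ C#T , cov) =
      T#
    , All.zipWith (uncurry All.++⁺) (t#T , C#T)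
    , All.map (λ { (inj₁ c∈C) → inj₁ (∈-++⁺ʳ t c∈C)
                 ; (inj₂ (here c∈t)) → inj₁ (∈-++⁺ˡ c∈t)
                 ; (inj₂ (there c∈T)) → inj₂ c∈T }) cov

  opaque
    unfolding exactCovers

    count-completions : ∀ C L →
      length (filter (completes? (board k n) C) (sublists (filter fitsBoard? L))) ≡ exactCovers C L
    count-completions C [] with all? (_∈? C) (board k n)
    ... | yes cov = cong length (filter-accept (completes? (board k n) C) {[]} {[]} ([] , [] , All.map inj₁ cov))
    ... | no ¬cov = cong length (filter-reject (completes? (board k n) C) {[]} {[]}
                      λ (_ , _ , cov) → ¬cov (All.map [ id , (λ ()) ]′ cov))
    count-completions C (t ∷ L) with fitsBoard? t
    ... | no  _ = trans (count-completions C L) (sym (ℕ.+-identityʳ _))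
    ... | yes _ = begin
      length (filter Q? (S ++ map (t ∷_) S))
        ≡⟨ cong length (filter-++ Q? S _) ⟩
      length (filter Q? S ++ filter Q? (map (t ∷_) S))
        ≡⟨ length-++ (filter Q? S) ⟩
      length (filter Q? S) + length (filter Q? (map (t ∷_) S))
        ≡⟨ cong₂ _+_ (count-completions C L) (length-filter-map Q? (t ∷_) S) ⟩
      exactCovers C L + length (filter (Q? ∘ (t ∷_)) S)
        ≡⟨ cong (λ v → exactCovers C L + v) (with-t (disjoint? C t)) ⟩
      exactCovers C L + (if does (disjoint? C t) then exactCovers (t ++ C) L else 0) ∎
      where
      open ≡-Reasoning
      Q? : U.Decidable (Completes (board k n) C)
      Q? = completes? (board k n) C
      S : List (List (List Cell))
      S = sublists (filter fitsBoard? L)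
      with-t : (d : Dec (Disjoint C t)) →
               length (filter (Q? ∘ (t ∷_)) S) ≡ (if does d then exactCovers (t ++ C) L else 0)
      with-t (yes C#t) = trans
        (cong length (filter-≐ (Q? ∘ (t ∷_)) (completes? (board k n) (t ++ C))
                               (completes-∷⁻ , completes-∷⁺ C#t) S))
        (count-completions (t ++ C) L)
      with-t (no ¬C#t) = cong length (filter-none (Q? ∘ (t ∷_))
                        (All.universal (λ T → λ { (_ , C#t ∷ _ , _) → ¬C#t C#t }) S))

    -- No remaining tile contains `c`, so it stays uncovered in every branch and the coverage test
    -- at the end fails.
    exactCovers-unreachable : ∀ {c C} L → c ∈ board k n → c ∉ C → All (c ∉_) L → exactCovers C L ≡ 0
    exactCovers-unreachable {c} {C} [] c∈B c∉C [] =
      cong (if_then 1 else 0) (dec-false (all? (_∈? C) (board k n)) λ cov → c∉C (All.lookup cov c∈B))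
    exactCovers-unreachable {c} {C} (t ∷ L) c∈B c∉C (c∉t ∷ c∉L)
      rewrite exactCovers-unreachable {C = C} L c∈B c∉C c∉L
      with does (fitsBoard? t) ∧ does (disjoint? C t)
    ... | false = refl
    ... | true  = exactCovers-unreachable L c∈B ([ c∉t , c∉C ]′ ∘ ∈-++⁻ t) c∉L

  allTiles : List (List Cell)
  allTiles = cartesianProductWith translate (board k n) shapes

  numTilings≡exactCovers : numTilings k n ≡ exactCovers [] allTiles
  numTilings≡exactCovers = trans
    (cong length (filter-≐ (isTiling? k n) (completes? (board k n) [])
      ( (λ (T# , cov) → T# , All.universal (λ _ → []) _ , All.map inj₂ cov)
      , (λ (T# , _ , cov) → T# , All.map [ (λ ()) , id ]′ cov))
      (sublists (tiles k n))))
    (count-completions [] allTiles)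

-- Windows and the counting operators

-- Windows record which of the next n cells, in the column-major order of the
-- board, are covered.
Window : ℕ → Set
Window = Vec Bool

-- Positions past the end read as uncovered; through this default `Records` also says that nothing
-- beyond the window is covered.
bit : ∀ {n} → Window n → ℕ → Bool
bit []      _       = false
bit (b ∷ w) zero    = b
bit (b ∷ w) (suc j) = bit w j

meets : ∀ {n} → Window n → Window n → Bool
meets []      []      = false
meets (a ∷ m) (b ∷ w) = (a ∧ b) ∨ meets m w

infixr 6 _∪_
_∪_ : ∀ {n} → Window n → Window n → Window n
_∪_ = zipWithᵛ _∨_

bit-tabulate⁺ : ∀ {n j} (f : ℕ → Bool) → j < n → f j ≡ true → bit (tabulate {n = n} (f ∘ toℕ)) j ≡ true
bit-tabulate⁺ {suc n} {zero}  f j<n       fj = fj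
bit-tabulate⁺ {suc n} {suc j} f (s≤s j<n) fj = bit-tabulate⁺ (f ∘ suc) j<n fj

bit-tabulate⁻ : ∀ {n} j (f : ℕ → Bool) → bit (tabulate {n = n} (f ∘ toℕ)) j ≡ true → f j ≡ true
bit-tabulate⁻ {suc n} zero    f b = b
bit-tabulate⁻ {suc n} (suc j) f b = bit-tabulate⁻ {n} j (f ∘ suc) b

bit-∪ : ∀ {n} (m w : Window n) j → bit (m ∪ w) j ≡ bit m j ∨ bit w j
bit-∪ []      []      j       = refl
bit-∪ (a ∷ m) (b ∷ w) zero    = refl
bit-∪ (a ∷ m) (b ∷ w) (suc j) = bit-∪ m w j

bit-∪⁺ˡ : ∀ {n} (m w : Window n) {j} → bit m j ≡ true → bit (m ∪ w) j ≡ true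
bit-∪⁺ˡ m w {j} mj = trans (bit-∪ m w j) (cong (_∨ bit w j) mj)

bit-∪⁺ʳ : ∀ {n} (m w : Window n) {j} → bit w j ≡ true → bit (m ∪ w) j ≡ true
bit-∪⁺ʳ m w {j} wj = trans (bit-∪ m w j) (trans (cong (bit m j ∨_) wj) (∨-zeroʳ _))

bit-∪⁻ : ∀ {n} (m w : Window n) {j} → bit (m ∪ w) j ≡ true → bit m j ≡ true ⊎ bit w j ≡ true
bit-∪⁻ m w {j} b with bit m j | trans (sym (bit-∪ m w j)) b
... | true  | _  = inj₁ refl
... | false | wj = inj₂ wj

bit-replicate-false : ∀ n j → bit (replicate n false) j ≡ false
bit-replicate-false zero    j       = refl
bit-replicate-false (suc n) zero    = refl
bit-replicate-false (suc n) (suc j) = bit-replicate-false n j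

bit-extend : ∀ {n} (w : Window n) k j → bit (w ++ᵛ replicate k false) j ≡ bit w j
bit-extend []      k j       = bit-replicate-false k j
bit-extend (b ∷ w) k zero    = refl
bit-extend (b ∷ w) k (suc j) = bit-extend w k j

meets⁺ : ∀ {n} (m w : Window n) {j} → bit m j ≡ true → bit w j ≡ true → meets m w ≡ true
meets⁺ (true ∷ m) (true ∷ w) {zero}  refl refl = refl
meets⁺ (a ∷ m)    (b ∷ w)    {suc j} mj   wj   =
  trans (cong ((a ∧ b) ∨_) (meets⁺ m w mj wj)) (∨-zeroʳ _)

meets⁻ : ∀ {n} (m w : Window n) → meets m w ≡ true → ∃[ j ] bit m j ≡ true × bit w j ≡ true
meets⁻ []          []          ()
meets⁻ (true  ∷ m) (true  ∷ w) _ = 0 , refl , refl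
meets⁻ (true  ∷ m) (false ∷ w) o with j , mj , wj ← meets⁻ m w o = suc j , mj , wj
meets⁻ (false ∷ m) (b     ∷ w) o with j , mj , wj ← meets⁻ m w o = suc j , mj , wj

δ₀ : ∀ {n} → Window n → ℕ
δ₀ []          = 1
δ₀ (true  ∷ w) = 0
δ₀ (false ∷ w) = δ₀ w

δ₀-blank : ∀ {n} (w : Window n) → (∀ j → bit w j ≢ true) → δ₀ w ≡ 1
δ₀-blank []          blank = refl
δ₀-blank (true  ∷ w) blank = contradiction refl (blank 0)
δ₀-blank (false ∷ w) blank = δ₀-blank w (blank ∘ suc)

-- The operators below send the number of completions as a function of the
-- window after a step to the same function before that step.

placing : ∀ {n} → Window n → (Window n → ℕ) → Window n → ℕ
placing m g w = if meets m w then 0 else g (m ∪ w)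

optionally : ∀ {n} → List (Window n) → (Window n → ℕ) → Window n → ℕ
optionally []       g w = g w
optionally (m ∷ ms) g w = optionally ms g w + placing m (optionally ms g) w

pass : ∀ {n} → (Window n → ℕ) → Window (suc n) → ℕ
pass g (true  ∷ w) = g w
pass g (false ∷ w) = 0

offset : Cell → ℕ
offset (x , y) = 9 * x + y

mask : ∀ n → List Cell → Window n
mask n s = tabulate λ j → does (toℕ j ∈ℕ? map offset s)

FitsColumn : ℕ → List Cell → Set
FitsColumn k = All λ c → proj₂ c < k

fitsColumn? : ∀ k → U.Decidable (FitsColumn k)
fitsColumn? k = all? λ c → proj₂ c <? k

Narrow : List Cell → Set
Narrow = All λ c → proj₁ c ≤ 2

-- `offset` would wrap a cell above the top of the board into the next column, so shapes taller than
-- the `k` cells left are removed before masks are formed.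
masks : ∀ k → List (List Cell) → List (Window (k + 18))
masks k ss = map (mask (k + 18)) (filter (fitsColumn? k) ss)

-- k is the number of cells of the column that are still to be passed.  The
-- window extends over the two following columns.
opaque
  cellSteps : ∀ k → (Window 18 → ℕ) → Window (k + 18) → ℕ
  cellSteps zero    g = g
  cellSteps (suc k) g = optionally (masks (suc k) shapes) (pass (cellSteps k g))

columnStep : (Window 18 → ℕ) → Window 18 → ℕ
columnStep g w = cellSteps 9 g (w ++ᵛ replicate 9 false)

columnSteps : ℕ → (Window 18 → ℕ) → Window 18 → ℕ
columnSteps zero    g = g
columnSteps (suc r) g = columnStep (columnSteps r g)

-- g vanishes when a cell after the next r ones, thus outside the board, is covered.
Confined : ∀ {n} → ℕ → (Window n → ℕ) → Set
Confined r g = ∀ w j → bit w j ≡ true → r ≤ j → g w ≡ 0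

δ₀-confined : ∀ {n} → Confined {n} 0 δ₀
δ₀-confined (true  ∷ w) j       _ _ = refl
δ₀-confined (false ∷ w) (suc j) b _ = δ₀-confined w j b z≤n

pass-confined : ∀ {n r} {g : Window n → ℕ} → Confined r g → Confined (suc r) (pass g)
pass-confined conf (false ∷ w) j       b r≤j       = refl
pass-confined conf (true  ∷ w) (suc j) b (s≤s r≤j) = conf w j b r≤j

optionally-confined : ∀ {n r} ms {g : Window n → ℕ} → Confined r g → Confined r (optionally ms g)
optionally-confined []       conf w j b r≤j = conf w j b r≤j
optionally-confined (m ∷ ms) conf w j b r≤j
  rewrite optionally-confined ms conf w j b r≤j
  with meets m w
... | true  = refl
... | false = optionally-confined ms conf (m ∪ w) j (bit-∪⁺ʳ m w b) r≤j

opaque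
  unfolding cellSteps

  cellSteps-confined : ∀ k {r g} → Confined r g → Confined (k + r) (cellSteps k g)
  cellSteps-confined zero    conf = conf
  cellSteps-confined (suc k) conf =
    optionally-confined (masks (suc k) shapes) (pass-confined (cellSteps-confined k conf))

-- The operators never test the right edge of the board. A tile sticking out there covers a cell
-- that is never passed, and `δ₀` finally gives it the value 0.
columnSteps-confined : ∀ r → Confined (9 * r) (columnSteps r δ₀)
columnSteps-confined zero          = δ₀-confined
columnSteps-confined (suc r) w j b 9r≤j =
  cellSteps-confined 9 (columnSteps-confined r) (w ++ᵛ replicate 9 false) j
    (trans (bit-extend w 9 j) b) (subst (_≤ j) (ℕ.*-suc 9 r) 9r≤j)

-- Offsets of cells and masks of tiles

offset-translate : ∀ x y dx dy → offset (x + dx , y + dy) ≡ offset (x , y) + offset (dx , dy)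
offset-translate x y dx dy =
  trans (cong (_+ (y + dy)) (ℕ.*-distribˡ-+ 9 x dx)) (+-interchange (9 * x) (9 * dx) y dy)

offset-<-column : ∀ {x x′ y} y′ → x < x′ → y < 9 → offset (x , y) < offset (x′ , y′)
offset-<-column {x} {x′} {y} y′ x<x′ y<9 = begin-strict
  9 * x + y      <⟨ ℕ.+-monoʳ-< (9 * x) y<9 ⟩
  9 * x + 9      ≡⟨ trans (ℕ.+-comm (9 * x) 9) (sym (ℕ.*-suc 9 x)) ⟩
  9 * suc x      ≤⟨ ℕ.*-monoʳ-≤ 9 x<x′ ⟩
  9 * x′         ≤⟨ ℕ.m≤m+n (9 * x′) y′ ⟩
  9 * x′ + y′    ∎
  where open ℕ.≤-Reasoning

offset-injective : ∀ x y x′ y′ → y < 9 → y′ < 9 → offset (x , y) ≡ offset (x′ , y′) → (x , y) ≡ (x′ , y′)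
offset-injective x y x′ y′ y<9 y′<9 eq with ℕ.<-cmp x x′
... | tri< x<x′ _ _ = contradiction eq (ℕ.<⇒≢ (offset-<-column y′ x<x′ y<9))
... | tri≈ _ refl _ = cong (x ,_) (ℕ.+-cancelˡ-≡ (9 * x) _ _ eq)
... | tri> _ _ x′<x = contradiction (sym eq) (ℕ.<⇒≢ (offset-<-column y x′<x y′<9))

translate⁻ : ∀ {c d s} → c ∈ translate d s →
  ∃[ e ] e ∈ s × c ≡ (proj₁ d + proj₁ e , proj₂ d + proj₂ e)
translate⁻ = ∈-map⁻ _

mask⁻ : ∀ n s j → bit (mask n s) j ≡ true → ∃[ e ] e ∈ s × j ≡ offset e
mask⁻ n s j b with j ∈ℕ? map offset s | bit-tabulate⁻ {n} j (λ j → does (j ∈ℕ? map offset s)) b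
... | yes j∈ | _ = ∈-map⁻ offset j∈

mask⁺ : ∀ {n s e} → e ∈ s → offset e < n → bit (mask n s) (offset e) ≡ true
mask⁺ {s = s} e∈s e<n = bit-tabulate⁺ (λ j → does (j ∈ℕ? map offset s)) e<n
  (dec-true (_ ∈ℕ? map offset s) (∈-map⁺ offset e∈s))

blank : Window 18
blank = replicate 18 false

-- Agreement of exact covers with the window operators

module _ (N : ℕ) where

  -- The covered cells C are the first p cells of the board and those recorded in w.
  record Records (p : ℕ) {n} (w : Window n) (C : List Cell) : Set where
    field
      before  : ∀ {c} → proj₂ c < 9 → offset c < p → c ∈ C
      window⁺ : ∀ {c} j → proj₂ c < 9 → offset c ≡ p + j → c ∈ C → bit w j ≡ true
      window⁻ : ∀ {c} j → proj₂ c < 9 → offset c ≡ p + j → bit w j ≡ true → c ∈ C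
      inside  : ∀ j → bit w j ≡ true → p + j < 9 * N
  open Records

  -- The invariant linking the two recursions. It is established from the end of the board
  -- backwards, since each side is defined by recursion on what is left.
  Counts : ℕ → ∀ {n} → (Window n → ℕ) → List (List Cell) → Set
  Counts p g L = ∀ {w C} → Records p w C → exactCovers 9 N C L ≡ g w

  ∈-board⁺ : ∀ {x y} → x < N → y < 9 → (x , y) ∈ board 9 N
  ∈-board⁺ x<N y<9 = ∈-cartesianProduct⁺ (∈-upTo⁺ x<N) (∈-upTo⁺ y<9)

  ∈-board⁻ : ∀ {x y} → (x , y) ∈ board 9 N → x < N × y < 9
  ∈-board⁻ c∈ with x∈ , y∈ ← ∈-cartesianProduct⁻ (upTo N) (upTo 9) c∈ = ∈-upTo⁻ x∈ , ∈-upTo⁻ y∈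

  offset-board : ∀ {x y} → x < N → y < 9 → offset (x , y) < 9 * N
  offset-board {x} {y} x<N y<9 =
    subst (offset (x , y) <_) (ℕ.+-identityʳ (9 * N)) (offset-<-column 0 x<N y<9)

  opaque
    unfolding exactCovers

    -- At `p = 9 * N` the field `before` puts every board cell into `C`, and `inside` leaves no bit
    -- of the window set, so both sides are 1.
    count-empty : Counts (9 * N) {18} δ₀ []
    count-empty {w} {C} rec = trans
      (cong (if_then 1 else 0) (dec-true (all? (_∈? C) (board 9 N))
        (All.tabulate λ c∈ → let x<N , y<9 = ∈-board⁻ c∈ in before rec y<9 (offset-board x<N y<9))))
      (sym (δ₀-blank w λ j b → ℕ.<⇒≱ (inside rec j b) (ℕ.m≤m+n (9 * N) j)))

  module _ {x y k : ℕ} (y+k≡9 : y + suc k ≡ 9) where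
    private
      p = offset (x , y)

    below : ∀ {dy} → dy < suc k → y + dy < 9
    below {dy} dy<k = subst (y + dy <_) y+k≡9 (ℕ.+-monoʳ-< y dy<k)

    inBoard⇒fits : ∀ s → All (_∈ board 9 N) (translate (x , y) s) → FitsColumn (suc k) s
    inBoard⇒fits s t⊆B = All.tabulate λ {e} e∈s → ℕ.+-cancelˡ-< y _ _
      (subst (y + proj₂ e <_) (sym y+k≡9) (proj₂ (∈-board⁻ (All.lookup t⊆B (∈-map⁺ _ e∈s)))))

    module _ {s : List Cell} (narrow : Narrow s) (fits : FitsColumn (suc k) s) where
      private
        t = translate (x , y) s
        m = mask (suc k + 18) s

      -- A tile reaches at most two columns further and fewer than `suc k` cells up; hence the
      -- window length `suc k + 18`.
      offset-bounded : ∀ {e} → e ∈ s → offset e < suc k + 18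
      offset-bounded {e} e∈s = subst (offset e <_) (ℕ.+-comm 18 (suc k))
        (ℕ.+-mono-≤-< (ℕ.*-monoʳ-≤ 9 (All.lookup narrow e∈s)) (All.lookup fits e∈s))

      tile⇒mask : ∀ {c} → c ∈ t → proj₂ c < 9 × ∃[ j ] offset c ≡ p + j × bit m j ≡ true
      tile⇒mask c∈t with (dx , dy) , e∈s , refl ← translate⁻ c∈t =
          below (All.lookup fits e∈s)
        , offset (dx , dy) , offset-translate x y dx dy
        , mask⁺ {n = suc k + 18} e∈s
            (offset-bounded e∈s)

      mask⇒tile : ∀ {c} j → proj₂ c < 9 → offset c ≡ p + j → bit m j ≡ true → c ∈ t
      mask⇒tile {x′ , y′} j y′<9 eq b with (dx , dy) , e∈s , refl ← mask⁻ (suc k + 18) s j b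
        with refl ← offset-injective x′ y′ (x + dx) (y + dy) y′<9 (below (All.lookup fits e∈s))
                      (trans eq (sym (offset-translate x y dx dy)))
        = ∈-map⁺ _ e∈s

      module _ {w : Window (suc k + 18)} {C : List Cell} (rec : Records p w C) where

        meets⇒¬disjoint : meets m w ≡ true → ¬ Disjoint C t
        meets⇒¬disjoint o C#t with j , mj , wj ← meets⁻ m w o
          with (dx , dy) , e∈s , refl ← mask⁻ (suc k + 18) s j mj =
          All.lookup C#t
            (window⁻ rec j (below (All.lookup fits e∈s)) (offset-translate x y dx dy) wj)
            (∈-map⁺ _ e∈s)

        ¬meets⇒disjoint : meets m w ≡ false → Disjoint C t
        ¬meets⇒disjoint o = All.tabulate λ c∈C c∈t →
          let y<9 , j , eq , mj = tile⇒mask c∈t in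
          contradiction (trans (sym (meets⁺ m w mj (window⁺ rec j y<9 eq c∈C))) o) λ ()

        records-∪ : All (_∈ board 9 N) t → Records p (m ∪ w) (t ++ C)
        records-∪ t⊆B .before y<9 c<p = ∈-++⁺ʳ t (before rec y<9 c<p)
        records-∪ t⊆B .window⁺ j y<9 eq c∈ with ∈-++⁻ t c∈
        ... | inj₂ c∈C = bit-∪⁺ʳ m w (window⁺ rec j y<9 eq c∈C)
        ... | inj₁ c∈t with _ , j′ , eq′ , mj ← tile⇒mask c∈t =
          bit-∪⁺ˡ m w (subst (λ j → bit m j ≡ true) (ℕ.+-cancelˡ-≡ p _ _ (trans (sym eq′) eq)) mj)
        records-∪ t⊆B .window⁻ j y<9 eq b with bit-∪⁻ m w b
        ... | inj₁ mj = ∈-++⁺ˡ (mask⇒tile j y<9 eq mj)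
        ... | inj₂ wj = ∈-++⁺ʳ t (window⁻ rec j y<9 eq wj)
        records-∪ t⊆B .inside j b with bit-∪⁻ m w b
        ... | inj₂ wj = inside rec j wj
        ... | inj₁ mj with (dx , dy) , e∈s , refl ← mask⁻ (suc k + 18) s j mj =
          subst (_< 9 * N) (offset-translate x y dx dy)
            (uncurry offset-board (∈-board⁻ (All.lookup t⊆B (∈-map⁺ _ e∈s))))

        -- The tile fits vertically, so it can leave the board only at the right edge. There it
        -- covers a cell at distance at least `r`, where the confined `g` vanishes.
        placing-outside : ∀ {r} {g : Window (suc k + 18) → ℕ} → p + r ≡ 9 * N → Confined r g →
          ¬ All (_∈ board 9 N) t → placing m g w ≡ 0
        placing-outside {r} {g} p+r≡9N conf t⊈B with meets m w
        ... | true  = refl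
        ... | false with All.all? (λ e → x + proj₁ e <? N) s
        ...   | yes t<N = contradiction
                  (All.tabulate λ c∈t → let e , e∈s , eq = translate⁻ c∈t in
                    subst (_∈ board 9 N) (sym eq)
                      (∈-board⁺ (All.lookup t<N e∈s) (below (All.lookup fits e∈s))))
                  t⊈B
        ...   | no t≮N with (dx , dy) , e∈s , x+dx≮N ← find (All.¬All⇒Any¬ (λ e → x + proj₁ e <? N) s t≮N) =
                conf (m ∪ w) (offset (dx , dy)) (bit-∪⁺ˡ m w mj) (ℕ.+-cancelˡ-≤ p _ _ (begin
                  p + r                          ≡⟨ p+r≡9N ⟩
                  9 * N                          ≤⟨ ℕ.*-monoʳ-≤ 9 (ℕ.≮⇒≥ x+dx≮N) ⟩
                  9 * (x + dx)                   ≤⟨ ℕ.m≤m+n _ (y + dy) ⟩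
                  offset (x + dx , y + dy)       ≡⟨ offset-translate x y dx dy ⟩
                  p + offset (dx , dy)           ∎))
          where
          open ℕ.≤-Reasoning
          mj : bit m (offset (dx , dy)) ≡ true
          mj = mask⁺ {n = suc k + 18} e∈s (offset-bounded e∈s)

    opaque
      unfolding exactCovers

      -- `exactCovers` and `optionally` branch on the shapes in the same order, so the counts are
      -- compared branch by branch. A shape that is too tall is absent from `masks` and rejected by
      -- `fitsBoard?`; a tile leaving on the right contributes 0 to the window side by confinement.
      tiles-at : ∀ {r L} {h : Window (suc k + 18) → ℕ} ss → All Narrow ss →
        p + r ≡ 9 * N → Confined r h → Counts p h L →
        Counts p (optionally (masks (suc k) ss) h) (map (translate (x , y)) ss ++ L)
      tiles-at []       _                p+r≡9N conf counts rec = counts rec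
      tiles-at {r} {L} {h} (s ∷ ss) (narrow ∷ narrows) p+r≡9N conf counts {w} {C} rec
        with fitsColumn? (suc k) s
      ... | no ¬fits rewrite dec-false (fitsBoard? 9 N (translate (x , y) s)) (¬fits ∘ inBoard⇒fits s) =
        trans (ℕ.+-identityʳ _) (tiles-at ss narrows p+r≡9N conf counts rec)
      ... | yes fits = cong₂ _+_ (rest rec)
            (included (fitsBoard? 9 N t) (disjoint? C t) (meets m w) refl)
        where
        t : List Cell
        t = translate (x , y) s
        m : Window (suc k + 18)
        m = mask (suc k + 18) s
        g : Window (suc k + 18) → ℕ
        g = optionally (masks (suc k) ss) h
        rest : Counts p g (map (translate (x , y)) ss ++ L)
        rest = tiles-at ss narrows p+r≡9N conf counts
        included : (d₁ : Dec (All (_∈ board 9 N) t)) (d₂ : Dec (Disjoint C t)) (b : Bool) → meets m w ≡ b →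
          (if does d₁ ∧ does d₂ then exactCovers 9 N (t ++ C) (map (translate (x , y)) ss ++ L) else 0)
          ≡ (if b then 0 else g (m ∪ w))
        included (no t⊈B) d₂ b refl =
          sym (placing-outside narrow fits rec p+r≡9N (optionally-confined (masks (suc k) ss) conf) t⊈B)
        included (yes t⊆B) (yes C#t)  true  o = contradiction C#t (meets⇒¬disjoint narrow fits rec o)
        included (yes t⊆B) (yes C#t)  false o = rest (records-∪ narrow fits rec t⊆B)
        included (yes t⊆B) (no  ¬C#t) true  o = refl
        included (yes t⊆B) (no  ¬C#t) false o = contradiction (¬meets⇒disjoint narrow fits rec o) ¬C#t

  tilesAt : List Cell → List (List Cell)
  tilesAt cs = cartesianProductWith translate cs shapes

  -- Weaker than following in column-major order, yet sufficient: shapes have coordinates at least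
  -- 0, so a tile translated by `d` has both coordinates at least those of `d`.
  Later : Cell → Cell → Set
  Later c d = proj₁ c < proj₁ d ⊎ proj₂ c < proj₂ d

  later⇒∉ : ∀ {c} cs → All (Later c) cs → All (c ∉_) (tilesAt cs)
  later⇒∉ {c} cs later = All.tabulate λ t∈ c∈t →
    let d , s , d∈cs , s∈shapes , t≡ = ∈-cartesianProductWith⁻ translate cs shapes t∈
        e , _ , c≡ = translate⁻ {d = d} {s} (subst (c ∈_) t≡ c∈t)
    in [ (λ c<d → ℕ.<⇒≱ c<d (subst (proj₁ d ≤_) (sym (cong proj₁ c≡)) (ℕ.m≤m+n _ _)))
       , (λ c<d → ℕ.<⇒≱ c<d (subst (proj₂ d ≤_) (sym (cong proj₂ c≡)) (ℕ.m≤m+n _ _))) ]′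
       (All.lookup later d∈cs)

  -- If the current cell is uncovered, no later tile reaches it and both sides are 0; if it is
  -- covered, it joins the cells before `p` and the window shifts by one.
  count-pass : ∀ {x y n} {g : Window n → ℕ} {cs} → x < N → y < 9 → All (Later (x , y)) cs →
    Counts (suc (offset (x , y))) g (tilesAt cs) → Counts (offset (x , y)) (pass g) (tilesAt cs)
  count-pass {x} {y} {cs = cs} x<N y<9 later counts {false ∷ w} {C} rec =
    exactCovers-unreachable 9 N (tilesAt cs) (∈-board⁺ x<N y<9)
      (λ c∈C → contradiction (window⁺ rec 0 y<9 (sym (ℕ.+-identityʳ _)) c∈C) λ ())
      (later⇒∉ cs later)
  count-pass {x} {y} x<N y<9 later counts {true ∷ w} {C} rec = counts rec′
    where
    p = offset (x , y)
    rec′ : Records (suc p) w C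
    rec′ .before {c} c<9 c≤p with ℕ.m≤n⇒m<n∨m≡n (ℕ.≤-pred c≤p)
    ... | inj₁ c<p = before rec c<9 c<p
    ... | inj₂ c≡p = window⁻ rec 0 c<9 (trans c≡p (sym (ℕ.+-identityʳ p))) refl
    rec′ .window⁺ j c<9 eq = window⁺ rec (suc j) c<9 (trans eq (sym (ℕ.+-suc p j)))
    rec′ .window⁻ j c<9 eq = window⁻ rec (suc j) c<9 (trans eq (sym (ℕ.+-suc p j)))
    rec′ .inside j b = subst (_< 9 * N) (ℕ.+-suc p j) (inside rec (suc j) b)

  -- The tail of a range is a range with the start raised by one, which suits the induction on
  -- columns and cells; `upTo` lacks this form.
  range : ℕ → ℕ → List ℕ
  range = iterate suc

  opaque
    unfolding cellSteps

    count-cells : ∀ {x cs r g} k y → y + k ≡ 9 → x < N → 9 * suc x + r ≡ 9 * N → Confined r g →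
      All (λ d → x < proj₁ d) cs → Counts (9 * suc x) g (tilesAt cs) →
      Counts (offset (x , y)) (cellSteps k g) (tilesAt (map (x ,_) (range y k) ++ cs))
    count-cells {x} {cs} {r} {g} zero y y+k≡9 x<N eq conf after counts {w} {C} =
      subst (λ p → Counts p g (tilesAt cs)) end counts
      where
      end : 9 * suc x ≡ 9 * x + y
      end = trans (ℕ.*-suc 9 x) (trans (ℕ.+-comm 9 (9 * x))
              (cong (λ v → 9 * x + v) (sym (trans (sym (ℕ.+-identityʳ y)) y+k≡9))))
    count-cells {x} {cs} {r} {g} (suc k) y y+k≡9 x<N eq conf after counts =
      tiles-at y+k≡9 {r = suc k + r} {L = tilesAt (map (x ,_) (range (suc y) k) ++ cs)} shapes
        (from-yes (all? (all? λ e → proj₁ e ≤? 2) shapes))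
        remaining (pass-confined (cellSteps-confined k conf))
        (count-pass x<N (ℕ.m+n≤o⇒m≤o (suc y) (ℕ.≤-reflexive y+k≡9′)) later
          (subst (λ p → Counts p (cellSteps k g) (tilesAt (map (x ,_) (range (suc y) k) ++ cs)))
            (ℕ.+-suc (9 * x) y)
            (count-cells k (suc y) y+k≡9′ x<N eq conf after counts)))
      where
      y+k≡9′ : suc y + k ≡ 9
      y+k≡9′ = trans (sym (ℕ.+-suc y k)) y+k≡9
      remaining : 9 * x + y + (suc k + r) ≡ 9 * N
      remaining = begin
        9 * x + y + (suc k + r)   ≡⟨ ℕ.+-assoc (9 * x) y (suc k + r) ⟩
        9 * x + (y + (suc k + r)) ≡⟨ cong (λ v → 9 * x + v) (sym (ℕ.+-assoc y (suc k) r)) ⟩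
        9 * x + (y + suc k + r)   ≡⟨ cong (λ n → 9 * x + (n + r)) y+k≡9 ⟩
        9 * x + (9 + r)           ≡⟨ sym (ℕ.+-assoc (9 * x) 9 r) ⟩
        9 * x + 9 + r             ≡⟨ cong (_+ r) (trans (ℕ.+-comm (9 * x) 9) (sym (ℕ.*-suc 9 x))) ⟩
        9 * suc x + r             ≡⟨ eq ⟩
        9 * N                     ∎
        where open ≡-Reasoning
      range-> : ∀ z k → y < z → All (y <_) (range z k)
      range-> z zero    y<z = []
      range-> z (suc k) y<z = y<z ∷ range-> (suc z) k (ℕ.m≤n⇒m≤1+n y<z)
      later : All (Later (x , y)) (map (x ,_) (range (suc y) k) ++ cs)
      later = All.++⁺ (All.map⁺ (All.map inj₂ (range-> (suc y) k ℕ.≤-refl))) (All.map inj₁ after)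

  count-columns : ∀ r x → x + r ≡ N →
    Counts (9 * x) (columnSteps r δ₀) (tilesAt (cartesianProduct (range x r) (range 0 9)))
  count-columns zero    x x+r≡N =
    subst (λ x → Counts (9 * x) δ₀ []) (trans (sym x+r≡N) (ℕ.+-identityʳ x)) count-empty
  count-columns (suc r) x x+r≡N {w} {C} rec =
    count-cells 9 0 refl x<N eq (columnSteps-confined r) (after (suc x) r ℕ.≤-refl)
      (count-columns r (suc x) x+r≡N′) rec′
    where
    x+r≡N′ : suc x + r ≡ N
    x+r≡N′ = trans (sym (ℕ.+-suc x r)) x+r≡N
    x<N : x < N
    x<N = ℕ.m+n≤o⇒m≤o (suc x) (ℕ.≤-reflexive x+r≡N′)
    eq : 9 * suc x + 9 * r ≡ 9 * N
    eq = trans (sym (ℕ.*-distribˡ-+ 9 (suc x) r)) (cong (9 *_) x+r≡N′)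
    after : ∀ z r → x < z → All (λ d → x < proj₁ d) (cartesianProduct (range z r) (range 0 9))
    after z zero    x<z = []
    after z (suc r) x<z = All.++⁺ (All.map⁺ {f = z ,_} (All.universal (λ _ → x<z) (range 0 9))) (after (suc z) r (ℕ.m≤n⇒m≤1+n x<z))
    p≡ : 9 * x ≡ offset (x , 0)
    p≡ = sym (ℕ.+-identityʳ (9 * x))
    -- The nine appended bits stand for the third column. `bit w` is false there, so the given
    -- record already says that those cells are uncovered.
    rec′ : Records (offset (x , 0)) (w ++ᵛ replicate 9 false) C
    rec′ .before {c} c<9 c<p = before rec c<9 (subst (offset c <_) (sym p≡) c<p)
    rec′ .window⁺ j c<9 eq c∈C =
      trans (bit-extend w 9 j) (window⁺ rec j c<9 (trans eq (cong (_+ j) (sym p≡))) c∈C)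
    rec′ .window⁻ j c<9 eq b =
      window⁻ rec j c<9 (trans eq (cong (_+ j) (sym p≡))) (trans (sym (bit-extend w 9 j)) b)
    rec′ .inside j b =
      subst (λ p → p + j < 9 * N) p≡ (inside rec j (trans (sym (bit-extend w 9 j)) b))

  upTo≡range : ∀ n → upTo n ≡ range 0 n
  upTo≡range n = go id 0 n λ _ → refl
    where
    go : ∀ (f : ℕ → ℕ) z n → (∀ i → f i ≡ z + i) → applyUpTo f n ≡ range z n
    go f z zero    f≡ = refl
    go f z (suc n) f≡ = cong₂ _∷_ (trans (f≡ 0) (ℕ.+-identityʳ z))
                          (go (f ∘ suc) (suc z) n λ i → trans (f≡ (suc i)) (ℕ.+-suc z i))

  numTilings≡columnSteps : numTilings 9 N ≡ columnSteps N δ₀ blank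
  numTilings≡columnSteps = begin
    numTilings 9 N
      ≡⟨ numTilings≡exactCovers 9 N ⟩
    exactCovers 9 N [] (tilesAt (cartesianProduct (upTo N) (upTo 9)))
      ≡⟨ cong (λ xs → exactCovers 9 N [] (tilesAt (cartesianProduct xs (upTo 9)))) (upTo≡range N) ⟩
    exactCovers 9 N [] (tilesAt (cartesianProduct (range 0 N) (range 0 9)))
      ≡⟨ count-columns N 0 refl blank-records ⟩
    columnSteps N δ₀ blank ∎
    where
    open ≡-Reasoning
    blank-bit : ∀ j → bit blank j ≢ true
    blank-bit j b = contradiction (trans (sym b) (bit-replicate-false 18 j)) λ ()
    blank-records : Records 0 blank []
    blank-records .before _ ()
    blank-records .window⁺ _ _ _ ()
    blank-records .window⁻ j _ _ b = contradiction b (blank-bit j)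
    blank-records .inside j b = contradiction b (blank-bit j)

-- Tries and adjoint operators

-- Finite multisets of windows, with multiplicities at the leaves.
data Trie : ℕ → Set where
  ∅    : ∀ {n} → Trie n
  leaf : ℕ → Trie 0
  node : ∀ {n} → Trie n → Trie n → Trie (suc n)

⟨_,_⟩ : ∀ {n} → Trie n → (Window n → ℕ) → ℕ
⟨ ∅        , g ⟩ = 0
⟨ leaf c   , g ⟩ = c * g []
⟨ node l r , g ⟩ = ⟨ l , g ∘ (false ∷_) ⟩ + ⟨ r , g ∘ (true ∷_) ⟩

-- Prunes empty subtrees, so that tries with the same support have the same form and `sameShape` can
-- compare them.
branch : ∀ {n} → Trie n → Trie n → Trie (suc n)
branch ∅ ∅ = ∅
branch l r = node l r

infixl 6 _⊕_
_⊕_ : ∀ {n} → Trie n → Trie n → Trie n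
∅          ⊕ t        = t
s@(leaf _) ⊕ ∅        = s
leaf a     ⊕ leaf b   = leaf (a + b)
s@(node _ _) ⊕ ∅      = s
node a b   ⊕ node c d = node (a ⊕ c) (b ⊕ d)

place : ∀ {n} → Window n → Trie n → Trie n
place m           ∅          = ∅
place []          (leaf c)   = leaf c
place (false ∷ m) (node l r) = branch (place m l) (place m r)
place (true  ∷ m) (node l r) = branch ∅ (place m l)

placeAll : ∀ {n} → List (Window n) → Trie n → Trie n
placeAll []       t = t
placeAll (m ∷ ms) t = placeAll ms (t ⊕ place m t)

covered : ∀ {n} → Trie (suc n) → Trie n
covered ∅          = ∅
covered (node l r) = r

singleton : ∀ k → ℕ → Trie k
singleton zero    c = leaf c
singleton (suc k) c = node (singleton k c) ∅

widen : ∀ {n} k → Trie n → Trie (n + k)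
widen k ∅          = ∅
widen k (leaf c)   = singleton k c
widen k (node l r) = node (widen k l) (widen k r)

opaque
  cellStepsᵀ : ∀ k → Trie (k + 18) → Trie 18
  cellStepsᵀ zero    t = t
  cellStepsᵀ (suc k) t = cellStepsᵀ k (covered (placeAll (masks (suc k) shapes) t))

columnStepᵀ : Trie 18 → Trie 18
columnStepᵀ t = cellStepsᵀ 9 (widen 9 t)

columnStepsᵀ : ℕ → Trie 18 → Trie 18
columnStepsᵀ zero    t = t
columnStepsᵀ (suc r) t = columnStepsᵀ r (columnStepᵀ t)

pairing-zero : ∀ {n} (t : Trie n) → ⟨ t , (λ _ → 0) ⟩ ≡ 0
pairing-zero ∅          = refl
pairing-zero (leaf c)   = ℕ.*-zeroʳ c
pairing-zero (node l r) = cong₂ _+_ (pairing-zero l) (pairing-zero r)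

pairing-+ : ∀ {n} (t : Trie n) g h → ⟨ t , (λ w → g w + h w) ⟩ ≡ ⟨ t , g ⟩ + ⟨ t , h ⟩
pairing-+ ∅          g h = refl
pairing-+ (leaf c)   g h = ℕ.*-distribˡ-+ c (g []) (h [])
pairing-+ (node l r) g h = trans (cong₂ _+_ (pairing-+ l _ _) (pairing-+ r _ _))
  (+-interchange ⟨ l , _ ⟩ ⟨ l , _ ⟩ ⟨ r , _ ⟩ ⟨ r , _ ⟩)

pairing-branch : ∀ {n} (l r : Trie n) g → ⟨ branch l r , g ⟩ ≡ ⟨ node l r , g ⟩
pairing-branch ∅            ∅          g = refl
pairing-branch ∅            (leaf _)   g = refl
pairing-branch ∅            (node _ _) g = refl
pairing-branch (leaf _)     r          g = refl
pairing-branch (node _ _)   r          g = refl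

pairing-⊕ : ∀ {n} (s t : Trie n) g → ⟨ s ⊕ t , g ⟩ ≡ ⟨ s , g ⟩ + ⟨ t , g ⟩
pairing-⊕ ∅          t          g = refl
pairing-⊕ (leaf a)   ∅          g = sym (ℕ.+-identityʳ _)
pairing-⊕ (leaf a)   (leaf b)   g = ℕ.*-distribʳ-+ (g []) a b
pairing-⊕ (node a b) ∅          g = sym (ℕ.+-identityʳ _)
pairing-⊕ (node a b) (node c d) g = trans (cong₂ _+_ (pairing-⊕ a c _) (pairing-⊕ b d _))
  (+-interchange ⟨ a , _ ⟩ ⟨ c , _ ⟩ ⟨ b , _ ⟩ ⟨ d , _ ⟩)

pairing-place : ∀ {n} m (t : Trie n) g → ⟨ place m t , g ⟩ ≡ ⟨ t , placing m g ⟩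
pairing-place m           ∅          g = refl
pairing-place []          (leaf c)   g = refl
pairing-place (false ∷ m) (node l r) g = trans (pairing-branch (place m l) (place m r) g)
  (cong₂ _+_ (pairing-place m l _) (pairing-place m r _))
pairing-place (true  ∷ m) (node l r) g = trans (pairing-branch ∅ (place m l) g)
  (trans (pairing-place m l _) (trans (sym (ℕ.+-identityʳ _)) (cong (λ v → ⟨ l , _ ⟩ + v) (sym (pairing-zero r)))))

-- Taking adjoints reverses composition: `optionally` applies the head `m` last, `placeAll` applies
-- it first.
pairing-placeAll : ∀ {n} ms (t : Trie n) g → ⟨ placeAll ms t , g ⟩ ≡ ⟨ t , optionally ms g ⟩
pairing-placeAll []       t g = refl
pairing-placeAll (m ∷ ms) t g = begin
  ⟨ placeAll ms (t ⊕ place m t) , g ⟩    ≡⟨ pairing-placeAll ms (t ⊕ place m t) g ⟩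
  ⟨ t ⊕ place m t , h ⟩                  ≡⟨ pairing-⊕ t (place m t) h ⟩
  ⟨ t , h ⟩ + ⟨ place m t , h ⟩          ≡⟨ cong (λ v → ⟨ t , h ⟩ + v) (pairing-place m t h) ⟩
  ⟨ t , h ⟩ + ⟨ t , placing m h ⟩        ≡⟨ sym (pairing-+ t h (placing m h)) ⟩
  ⟨ t , optionally (m ∷ ms) g ⟩          ∎
  where
  open ≡-Reasoning
  h = optionally ms g

pairing-covered : ∀ {n} (t : Trie (suc n)) g → ⟨ covered t , g ⟩ ≡ ⟨ t , pass g ⟩
pairing-covered ∅          g = refl
pairing-covered (node l r) g = cong (_+ ⟨ r , g ⟩) (sym (pairing-zero l))

pairing-singleton : ∀ k c g → ⟨ singleton k c , g ⟩ ≡ c * g (replicate k false)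
pairing-singleton zero    c g = refl
pairing-singleton (suc k) c g = trans (ℕ.+-identityʳ _) (pairing-singleton k c _)

pairing-widen : ∀ {n} k (t : Trie n) g → ⟨ widen k t , g ⟩ ≡ ⟨ t , (λ w → g (w ++ᵛ replicate k false)) ⟩
pairing-widen k ∅          g = refl
pairing-widen k (leaf c)   g = pairing-singleton k c g
pairing-widen k (node l r) g = cong₂ _+_ (pairing-widen k l _) (pairing-widen k r _)

opaque
  unfolding cellSteps cellStepsᵀ

  pairing-cellSteps : ∀ k (t : Trie (k + 18)) g → ⟨ cellStepsᵀ k t , g ⟩ ≡ ⟨ t , cellSteps k g ⟩
  pairing-cellSteps zero    t g = refl
  pairing-cellSteps (suc k) t g = trans (pairing-cellSteps k (covered (placeAll (masks (suc k) shapes) t)) g)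
    (trans (pairing-covered (placeAll (masks (suc k) shapes) t) (cellSteps k g))
      (pairing-placeAll (masks (suc k) shapes) t (pass (cellSteps k g))))

pairing-columnSteps : ∀ r (t : Trie 18) g → ⟨ columnStepsᵀ r t , g ⟩ ≡ ⟨ t , columnSteps r g ⟩
pairing-columnSteps zero    t g = refl
pairing-columnSteps (suc r) t g = trans (pairing-columnSteps r (columnStepᵀ t) g)
  (trans (pairing-cellSteps 9 (widen 9 t) (columnSteps r g)) (pairing-widen 9 t (cellSteps 9 (columnSteps r g))))

pairing-* : ∀ {n} (t : Trie n) c g → ⟨ t , (λ w → c * g w) ⟩ ≡ c * ⟨ t , g ⟩
pairing-* ∅          c g = sym (ℕ.*-zeroʳ c)
pairing-* (leaf a)   c g = begin
  a * (c * g [])   ≡⟨ sym (ℕ.*-assoc a c (g [])) ⟩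
  a * c * g []     ≡⟨ cong (_* g []) (ℕ.*-comm a c) ⟩
  c * a * g []     ≡⟨ ℕ.*-assoc c a (g []) ⟩
  c * (a * g [])   ∎
  where open ≡-Reasoning
pairing-* (node l r) c g = trans (cong₂ _+_ (pairing-* l c _) (pairing-* r c _))
  (sym (ℕ.*-distribˡ-+ c ⟨ l , _ ⟩ ⟨ r , _ ⟩))

-- The terms of the pairing are natural numbers, so a zero sum forces each to be zero: at every leaf
-- the multiplicity or `e` vanishes. This is the positivity argument behind `agreement`.
pairing-vanishing : ∀ {n} (t : Trie n) {e g h : Window n → ℕ} → (∀ w → e w ≡ 0 → g w ≡ h w) →
  ⟨ t , e ⟩ ≡ 0 → ⟨ t , g ⟩ ≡ ⟨ t , h ⟩
pairing-vanishing ∅          e⇒ eq = refl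
pairing-vanishing (leaf c)   e⇒ eq with ℕ.m*n≡0⇒m≡0∨n≡0 c eq
... | inj₁ refl = refl
... | inj₂ e≡0  = cong (c *_) (e⇒ [] e≡0)
pairing-vanishing (node l r) e⇒ eq = cong₂ _+_
  (pairing-vanishing l (λ _ → e⇒ _) (ℕ.m+n≡0⇒m≡0 ⟨ l , _ ⟩ eq))
  (pairing-vanishing r (λ _ → e⇒ _) (ℕ.m+n≡0⇒n≡0 ⟨ l , _ ⟩ eq))

-- Dot products, linearity, and samples at the leaves of a trie

dot : List ℕ → List ℕ → ℕ
dot (x ∷ xs) (y ∷ ys) = x * y + dot xs ys
-- The longer list is cut off, so a coefficient list can meet a longer history or, in a convolution
-- of low degree, a shorter one.
dot _        _        = 0

dot-++ : ∀ xs {ys} xs′ {ys′} → length xs ≡ length xs′ → dot (xs ++ ys) (xs′ ++ ys′) ≡ dot xs xs′ + dot ys ys′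
dot-++ []       []         _  = refl
dot-++ (x ∷ xs) (x′ ∷ xs′) eq =
  trans (cong (λ v → x * x′ + v) (dot-++ xs xs′ (ℕ.suc-injective eq))) (sym (ℕ.+-assoc (x * x′) _ _))

pairing-dot : ∀ {n} (t : Trie n) cs (g : ℕ → Window n → ℕ) js →
  ⟨ t , (λ w → dot cs (map (λ j → g j w) js)) ⟩ ≡ dot cs (map (λ j → ⟨ t , g j ⟩) js)
pairing-dot t []       g js       = pairing-zero t
pairing-dot t (c ∷ cs) g []       = pairing-zero t
pairing-dot t (c ∷ cs) g (j ∷ js) = trans
  (pairing-+ t (λ w → c * g j w) (λ w → dot cs (map (λ j → g j w) js)))
  (cong₂ _+_ (pairing-* t c (g j)) (pairing-dot t cs g js))

only : ∀ {n} → Window n → Trie n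
only []          = leaf 1
only (false ∷ w) = node (only w) ∅
only (true  ∷ w) = node ∅ (only w)

pairing-only : ∀ {n} (w : Window n) g → ⟨ only w , g ⟩ ≡ g w
pairing-only []          g = ℕ.*-identityˡ (g [])
pairing-only (false ∷ w) g = trans (ℕ.+-identityʳ _) (pairing-only w _)
pairing-only (true  ∷ w) g = pairing-only w _

-- Every value of `columnSteps r g` is a pairing with a fixed trie, so linearity and positivity of
-- the operator are inherited from the pairing.
columnSteps≡pairing : ∀ r g w → columnSteps r g w ≡ ⟨ columnStepsᵀ r (only w) , g ⟩
columnSteps≡pairing r g w = sym (trans (pairing-columnSteps r (only w) g) (pairing-only w (columnSteps r g)))

columnSteps-dot : ∀ r cs g js w →
  columnSteps r (λ w → dot cs (map (λ j → g j w) js)) w ≡ dot cs (map (λ j → columnSteps r (g j) w) js)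
columnSteps-dot r cs g js w = trans (columnSteps≡pairing r _ w)
  (trans (pairing-dot (columnStepsᵀ r (only w)) cs g js)
    (cong (dot cs) (map-cong (λ j → sym (columnSteps≡pairing r (g j) w)) js)))

columnSteps-vanishing : ∀ r {e g h} → (∀ w → e w ≡ 0 → g w ≡ h w) →
  ∀ w → columnSteps r e w ≡ 0 → columnSteps r g w ≡ columnSteps r h w
columnSteps-vanishing r {e} {g} {h} e⇒ w eq = trans (columnSteps≡pairing r g w)
  (trans (pairing-vanishing (columnStepsᵀ r (only w)) e⇒ (trans (sym (columnSteps≡pairing r e w)) eq))
    (sym (columnSteps≡pairing r h w)))

columnSteps-+ : ∀ r s g → columnSteps (r + s) g ≡ columnSteps r (columnSteps s g)
columnSteps-+ zero    s g = refl
columnSteps-+ (suc r) s g = cong columnStep (columnSteps-+ r s g)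

weights : ∀ {n} → Trie n → List ℕ
weights ∅          = []
weights (leaf c)   = c ∷ []
weights (node l r) = weights l ++ weights r

sample : ∀ {n} → Trie n → (Window n → ℕ) → List ℕ
sample ∅          g = []
sample (leaf c)   g = g [] ∷ []
sample (node l r) g = sample l (g ∘ (false ∷_)) ++ sample r (g ∘ (true ∷_))

size : ∀ {n} → Trie n → ℕ
size ∅          = 0
size (leaf _)   = 1
size (node l r) = size l + size r

length-sample : ∀ {n} (t : Trie n) g → length (sample t g) ≡ size t
length-sample ∅          g = refl
length-sample (leaf c)   g = refl
length-sample (node l r) g = trans (length-++ (sample l _)) (cong₂ _+_ (length-sample l _) (length-sample r _))

length-weights : ∀ {n} (t : Trie n) → length (weights t) ≡ size t
length-weights ∅          = refl
length-weights (leaf c)   = refl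
length-weights (node l r) = trans (length-++ (weights l)) (cong₂ _+_ (length-weights l) (length-weights r))

pairing≡dot : ∀ {n} (t : Trie n) g → ⟨ t , g ⟩ ≡ dot (weights t) (sample t g)
pairing≡dot ∅          g = refl
pairing≡dot (leaf c)   g = sym (ℕ.+-identityʳ _)
pairing≡dot (node l r) g = trans (cong₂ _+_ (pairing≡dot l _) (pairing≡dot r _))
  (sym (dot-++ (weights l) (sample l _) (trans (length-weights l) (sym (length-sample l _)))))

zipWith-++ : ∀ (f : ℕ → ℕ → ℕ) xs {ys} xs′ {ys′} → length xs ≡ length xs′ →
  zipWith f (xs ++ ys) (xs′ ++ ys′) ≡ zipWith f xs xs′ ++ zipWith f ys ys′
zipWith-++ f []       []         _  = refl
zipWith-++ f (x ∷ xs) (x′ ∷ xs′) eq = cong (f x x′ ∷_) (zipWith-++ f xs xs′ (ℕ.suc-injective eq))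

sample-zipWith : ∀ {n} (t : Trie n) f g h → sample t (λ w → f (g w) (h w)) ≡ zipWith f (sample t g) (sample t h)
sample-zipWith ∅          f g h = refl
sample-zipWith (leaf c)   f g h = refl
sample-zipWith (node l r) f g h = trans (cong₂ _++_ (sample-zipWith l f _ _) (sample-zipWith r f _ _))
  (sym (zipWith-++ f (sample l _) (sample l _) (trans (length-sample l _) (sym (length-sample l _)))))

sameShape : ∀ {n} → Trie n → Trie n → Bool
sameShape ∅          ∅          = true
sameShape (leaf _)   (leaf _)   = true
sameShape (node a b) (node c d) = sameShape a c ∧ sameShape b d
sameShape _          _          = false

∧-split : ∀ {x y} → T (x ∧ y) → T x × T y
∧-split = Equivalence.to T-∧

sameShape⇒sample≡ : ∀ {n} (s t : Trie n) → T (sameShape s t) → ∀ g → sample s g ≡ sample t g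
sameShape⇒sample≡ ∅          ∅          _  g = refl
sameShape⇒sample≡ (leaf _)   (leaf _)   _  g = refl
sameShape⇒sample≡ (node a b) (node c d) ok g with ok₁ , ok₂ ← ∧-split {sameShape a c} ok =
  cong₂ _++_ (sameShape⇒sample≡ a c ok₁ _) (sameShape⇒sample≡ b d ok₂ _)

startsBlank : ∀ {n} → Trie n → Bool
startsBlank ∅          = false
startsBlank (leaf _)   = true
startsBlank (node l _) = startsBlank l

-- Puts the value at the empty window at the head of every sample, where `heads` reads off the
-- number of tilings.
startsBlank⇒ : ∀ {n} (t : Trie n) → T (startsBlank t) → ∀ g → ∃[ vs ] sample t g ≡ g (replicate n false) ∷ vs
startsBlank⇒ (leaf _)   ok g = [] , refl
startsBlank⇒ (node l r) ok g with vs , eq ← startsBlank⇒ l ok (g ∘ (false ∷_)) =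
  vs ++ sample r _ , cong (_++ sample r _) eq

-- Packing a function on R into one number

fromDigits : ℕ → List ℕ → ℕ
fromDigits b []       = 0
fromDigits b (v ∷ vs) = v + b * fromDigits b vs

-- The i-th leaf is given the weight b ^ i, times c.
powers-end : ∀ {n} → ℕ → ℕ → Trie n → ℕ
powers-end b c ∅          = c
powers-end b c (leaf _)   = c * b
powers-end b c (node l r) = powers-end b (powers-end b c l) r

powers : ∀ {n} → ℕ → ℕ → Trie n → Trie n
powers b c ∅          = ∅
powers b c (leaf _)   = leaf c
powers b c (node l r) = node (powers b c l) (powers b (powers-end b c l) r)

-- The list `vs` holds the digits that follow those of `t`. With it, the left subtree can be
-- followed by the right one, whose weights start at `powers-end b c l`.
pairing-powers-++ : ∀ {n} b c (t : Trie n) g vs →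
  ⟨ powers b c t , g ⟩ + powers-end b c t * fromDigits b vs ≡ c * fromDigits b (sample t g ++ vs)
pairing-powers-++ b c ∅          g vs = refl
pairing-powers-++ b c (leaf _)   g vs = trans (cong (λ v → c * g [] + v) (ℕ.*-assoc c b _))
  (sym (ℕ.*-distribˡ-+ c (g []) (b * fromDigits b vs)))
pairing-powers-++ b c (node l r) g vs = begin
  L + R + e′ * D                        ≡⟨ ℕ.+-assoc L R (e′ * D) ⟩
  L + (R + e′ * D)                      ≡⟨ cong (λ v → L + v) (pairing-powers-++ b e r _ vs) ⟩
  L + e * fromDigits b (sr ++ vs)       ≡⟨ pairing-powers-++ b c l _ (sr ++ vs) ⟩
  c * fromDigits b (sl ++ (sr ++ vs))   ≡⟨ cong (λ vs → c * fromDigits b vs) (sym (++-assoc sl sr vs)) ⟩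
  c * fromDigits b ((sl ++ sr) ++ vs)   ∎
  where
  open ≡-Reasoning
  e = powers-end b c l
  e′ = powers-end b e r
  D = fromDigits b vs
  L = ⟨ powers b c l , g ∘ (false ∷_) ⟩
  R = ⟨ powers b e r , g ∘ (true ∷_) ⟩
  sl = sample l (g ∘ (false ∷_))
  sr = sample r (g ∘ (true ∷_))

pairing-powers : ∀ {n} b (t : Trie n) g → ⟨ powers b 1 t , g ⟩ ≡ fromDigits b (sample t g)
pairing-powers b t g = begin
  ⟨ powers b 1 t , g ⟩                              ≡⟨ sym (ℕ.+-identityʳ _) ⟩
  ⟨ powers b 1 t , g ⟩ + 0                          ≡⟨ cong (λ v → ⟨ powers b 1 t , g ⟩ + v) (sym (ℕ.*-zeroʳ (powers-end b 1 t))) ⟩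
  ⟨ powers b 1 t , g ⟩ + powers-end b 1 t * 0       ≡⟨ pairing-powers-++ b 1 t g [] ⟩
  1 * fromDigits b (sample t g ++ [])               ≡⟨ ℕ.*-identityˡ _ ⟩
  fromDigits b (sample t g ++ [])                   ≡⟨ cong (fromDigits b) (++-identityʳ (sample t g)) ⟩
  fromDigits b (sample t g)                         ∎
  where open ≡-Reasoning

-- Here and below the base is suc b.
digits : ℕ → ℕ → ℕ → List ℕ
digits b zero    N = []
digits b (suc k) N = N % suc b ∷ digits b k (N / suc b)

-- Every digit is at most the digit sum, which is found by evaluating at 1.
digits-fromDigits : ∀ b vs → fromDigits 1 vs < suc b → digits b (length vs) (fromDigits (suc b) vs) ≡ vs
digits-fromDigits b []       _   = refl
digits-fromDigits b (v ∷ vs) sum<b = cong₂ _∷_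
  (trans (cong (λ x → (v + x) % suc b) (ℕ.*-comm (suc b) D)) (trans ([m+kn]%n≡m%n v D (suc b)) (m<n⇒m%n≡m v<b)))
  (trans (cong (digits b (length vs)) (begin
    (v + suc b * D) / suc b              ≡⟨ cong (λ x → (v + x) / suc b) (ℕ.*-comm (suc b) D) ⟩
    (v + D * suc b) / suc b              ≡⟨ +-distrib-/-∣ʳ v (divides-refl D) ⟩
    v / suc b + D * suc b / suc b        ≡⟨ cong₂ _+_ (m<n⇒m/n≡0 v<b) (m*n/n≡m D (suc b)) ⟩
    D                                    ∎))
    (digits-fromDigits b vs (ℕ.≤-<-trans (ℕ.≤-trans (ℕ.≤-reflexive (sym (ℕ.+-identityʳ _))) (ℕ.m≤n+m _ v)) sum<b)))
  where
  open ≡-Reasoning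
  D = fromDigits (suc b) vs
  v<b = ℕ.≤-<-trans (ℕ.m≤m+n v _) sum<b

fromDigits-zero : ∀ vs → fromDigits 1 vs ≡ 0 → All (_≡ 0) vs
fromDigits-zero []       _  = []
fromDigits-zero (v ∷ vs) eq = ℕ.m+n≡0⇒m≡0 v eq
  ∷ fromDigits-zero vs (trans (sym (ℕ.+-identityʳ _)) (ℕ.m+n≡0⇒n≡0 v eq))

dot-zero : ∀ cs {vs} → All (_≡ 0) vs → dot cs vs ≡ 0
dot-zero []       _            = refl
dot-zero (c ∷ cs) []           = refl
dot-zero (c ∷ cs) (refl ∷ vs) = cong₂ _+_ (ℕ.*-zeroʳ c) (dot-zero cs vs)

zipWith-∣-∣-zero : ∀ vs → All (_≡ 0) (zipWith ∣_-_∣ vs vs)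
zipWith-∣-∣-zero []       = []
zipWith-∣-∣-zero (v ∷ vs) = ℕ.∣n-n∣≡0 v ∷ zipWith-∣-∣-zero vs

-- The period of eight columns and its history on `R`

period : (Window 18 → ℕ) → Window 18 → ℕ
period = columnSteps 8

periodᵀ : Trie 18 → Trie 18
periodᵀ = columnStepsᵀ 8

opaque
  count : ℕ → Window 18 → ℕ
  count j = columnSteps (8 * j) δ₀

  count-+ : ∀ m j → columnSteps (8 * m) (count j) ≡ count (m + j)
  count-+ m j = trans (sym (columnSteps-+ (8 * m) (8 * j) δ₀))
    (cong (λ r → columnSteps r δ₀) (sym (ℕ.*-distribˡ-+ 8 m j)))

  δ₀≡count : δ₀ ≡ count 0
  δ₀≡count = refl

extend : ℕ → List ℕ → List (List ℕ) → List (List ℕ)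
extend b cs []       = []
extend b cs (v ∷ vs) = digits b (length v) (dot cs v) ∷ v ∷ vs

-- The newest sample comes first, matching `downFrom` and the order of the coefficients in a
-- convolution.
history : ℕ → List ℕ → List ℕ → ℕ → List (List ℕ)
history b cs v zero    = v ∷ []
history b cs v (suc n) = extend b cs (history b cs v n)

-- `z` is to be the zero sample: `zipWith` truncates, so the empty combination must have full
-- length.
combine : List ℕ → List ℕ → List (List ℕ) → List ℕ
combine z (c ∷ cs) (v ∷ vs) = zipWith (λ x y → c * x + y) v (combine z cs vs)
combine z _        _        = z

listEq : List ℕ → List ℕ → Bool
listEq []       []       = true
listEq (x ∷ xs) (y ∷ ys) = (x ≡ᵇ y) ∧ listEq xs ys
listEq _        _        = false

listEq⇒≡ : ∀ xs ys → T (listEq xs ys) → xs ≡ ys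
listEq⇒≡ []       []       _  = refl
listEq⇒≡ (x ∷ xs) (y ∷ ys) ok with ok₁ , ok₂ ← ∧-split {x ≡ᵇ y} ok =
  cong₂ _∷_ (ℕ.≡ᵇ⇒≡ x y ok₁) (listEq⇒≡ xs ys ok₂)

-- With the base 1 weights as `cs`, each dot product is the digit sum of the following sample; below
-- the base, that sample is decoded correctly.
allBelow : ℕ → List ℕ → List (List ℕ) → Bool
allBelow b cs []       = true
allBelow b cs (v ∷ vs) = (dot cs v <ᵇ suc b) ∧ allBelow b cs vs

-- R is closed under the period: its image has the same shape.
module Closed (b : ℕ) (R : Trie 18)
  (shape₁ : T (sameShape (periodᵀ (powers 1 1 R)) R))
  (shapeᵦ : T (sameShape (periodᵀ (powers (suc b) 1 R)) R)) where

  private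
    cs₁ = weights (periodᵀ (powers 1 1 R))
    csᵦ = weights (periodᵀ (powers (suc b) 1 R))

  -- Used for two bases: `suc b` yields the packed next sample, and 1 yields its digit sum.
  dot-period : ∀ c → T (sameShape (periodᵀ (powers c 1 R)) R) → ∀ g →
    dot (weights (periodᵀ (powers c 1 R))) (sample R g) ≡ fromDigits c (sample R (period g))
  dot-period c shape g = begin
    dot (weights t) (sample R g)       ≡⟨ cong (dot (weights t)) (sym (sameShape⇒sample≡ t R shape g)) ⟩
    dot (weights t) (sample t g)       ≡⟨ sym (pairing≡dot t g) ⟩
    ⟨ t , g ⟩                          ≡⟨ pairing-columnSteps 8 (powers c 1 R) g ⟩
    ⟨ powers c 1 R , period g ⟩        ≡⟨ pairing-powers c R (period g) ⟩
    fromDigits c (sample R (period g)) ∎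
    where
    open ≡-Reasoning
    t = periodᵀ (powers c 1 R)

  step-sample : ∀ g → dot cs₁ (sample R g) < suc b →
    digits b (length (sample R g)) (dot csᵦ (sample R g)) ≡ sample R (period g)
  step-sample g small = begin
    digits b (length (sample R g)) (dot csᵦ (sample R g))
      ≡⟨ cong₂ (digits b) (trans (length-sample R g) (sym (length-sample R (period g)))) (dot-period (suc b) shapeᵦ g) ⟩
    digits b (length (sample R (period g))) (fromDigits (suc b) (sample R (period g)))
      ≡⟨ digits-fromDigits b (sample R (period g)) (subst (_< suc b) (dot-period 1 shape₁ g) small) ⟩
    sample R (period g) ∎
    where open ≡-Reasoning

  samples : ℕ → List (List ℕ)
  samples n = map (λ j → sample R (count j)) (downFrom (suc n))

  history≡samples : ∀ n → T (allBelow b cs₁ (history b csᵦ (sample R δ₀) n)) →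
    history b csᵦ (sample R δ₀) n ≡ samples n
  history≡samples zero    _  = cong (λ g → sample R g ∷ []) δ₀≡count
  history≡samples (suc n) ok with history b csᵦ (sample R δ₀) n | history≡samples n
  ... | [] | ih with () ← ih _
  ... | v ∷ vs | ih with ok₁ , ok₂ ← ∧-split {dot cs₁ (digits b (length v) (dot csᵦ v)) <ᵇ suc b} ok
    with refl ← ih ok₂ = cong (_∷ samples n)
      (trans (step-sample (count n) (ℕ.<ᵇ⇒< _ _ (proj₁ (∧-split {dot cs₁ (sample R (count n)) <ᵇ suc b} ok₂))))
             (cong (sample R) (count-+ 1 n)))

  combine-samples : ∀ cs n → combine (sample R λ _ → 0) cs (samples n) ≡
    sample R (λ w → dot cs (map (λ j → count j w) (downFrom (suc n))))
  combine-samples cs n = go cs (downFrom (suc n))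
    where
    go : ∀ cs js → combine (sample R λ _ → 0) cs (map (λ j → sample R (count j)) js) ≡
                   sample R (λ w → dot cs (map (λ j → count j w) js))
    go []       js       = refl
    go (c ∷ cs) []       = refl
    go (c ∷ cs) (j ∷ js) = trans
      (cong (zipWith (λ x y → c * x + y) (sample R (count j))) (go cs js))
      (sym (sample-zipWith R (λ x y → c * x + y) (count j) _))

  -- The function `∣ g - h ∣` vanishes on `R`. By `dot-period` in base 1, the sum over `R` of its
  -- image under the period is a combination of these zeros, so the image vanishes on `R` too, and
  -- so on inductively. At the empty window positivity then gives equality.
  agreement : T (startsBlank R) → ∀ {g h} → sample R g ≡ sample R h →
    ∀ m → columnSteps (8 * m) g blank ≡ columnSteps (8 * m) h blank
  agreement starts {g} {h} g≡h m =
    columnSteps-vanishing (8 * m) (λ w → ℕ.∣m-n∣≡0⇒m≡n) blank (head-zero (zero-on m))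
    where
    e : Window 18 → ℕ
    e w = ∣ g w - h w ∣
    zero-on : ∀ m → All (_≡ 0) (sample R (columnSteps (8 * m) e))
    zero-on zero    = subst (All (_≡ 0))
      (sym (trans (sample-zipWith R ∣_-_∣ g h) (cong (zipWith ∣_-_∣ (sample R g)) (sym g≡h))))
      (zipWith-∣-∣-zero (sample R g))
    zero-on (suc m) = subst (λ f → All (_≡ 0) (sample R f))
      (trans (sym (columnSteps-+ 8 (8 * m) e)) (cong (λ r → columnSteps r e) (sym (ℕ.*-suc 8 m))))
      (fromDigits-zero _ (trans (sym (dot-period 1 shape₁ (columnSteps (8 * m) e))) (dot-zero cs₁ (zero-on m))))
    head-zero : ∀ {f} → All (_≡ 0) (sample R f) → f blank ≡ 0
    head-zero {f} zeros with vs , eq ← startsBlank⇒ R starts f with e≡0 ∷ _ ← subst (All (_≡ 0)) eq zeros = e≡0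

opaque
  unfolding count

  numTilings≡count : ∀ n → numTilings 9 (8 * n) ≡ count n blank
  numTilings≡count n = numTilings≡columnSteps (8 * n)

-- Convolutions and the certificate for the recurrence

convolution : List ℕ → (ℕ → ℕ) → ℕ → ℕ
convolution cs f n = dot cs (map f (downFrom (suc n)))

convolution-cong : ∀ cs {f g} n → (∀ j → f j ≡ g j) → convolution cs f n ≡ convolution cs g n
convolution-cong cs n f≡g = cong (dot cs) (map-cong f≡g (downFrom (suc n)))

dot-downFrom-+ : ∀ cs f m k → length cs ≤ k →
  dot cs (map f (downFrom (m + k))) ≡ dot cs (map (λ j → f (m + j)) (downFrom k))
dot-downFrom-+ []       f m k       _ = refl
dot-downFrom-+ (c ∷ cs) f m (suc k) (s≤s len) rewrite ℕ.+-suc m k =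
  cong (λ x → c * f (m + k) + x) (dot-downFrom-+ cs f m k len)

heads : List (List ℕ) → List ℕ
heads = map (fromMaybe 0 ∘ head)

-- as lists the counts from f 148 down to f 0.  On R the relation between the f j
-- fails for f 147, … , f 1, so the recurrence for f 147 is checked separately.
checkCounts : List ℕ → List ℕ → List ℕ → List ℕ → Bool
checkCounts ps qs is as =
  listEq (drop 142 as) is ∧
  ((dot ps (drop 1 as) ≡ᵇ dot qs (drop 1 as)) ∧
   not (dot ps (drop 2 as) ≡ᵇ dot qs (drop 2 as)))

checkHistory : ℕ → List ℕ → List ℕ → List ℕ → List ℕ → List ℕ → List (List ℕ) → Bool
checkHistory b cs z ps qs is vss =
  allBelow b cs vss ∧
  (listEq (combine z ps vss) (combine z qs vss) ∧
   checkCounts ps qs is (heads vss))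

-- The images of the two weighted tries, and then the history, are passed as arguments so that
-- evaluation shares them among the tests.
checkTries : ℕ → ℕ → List ℕ → List ℕ → List ℕ → (R S₁ Sᵦ : Trie 18) → Bool
checkTries n b ps qs is R S₁ Sᵦ =
  startsBlank R ∧ (sameShape S₁ R ∧ (sameShape Sᵦ R ∧
  checkHistory b (weights S₁) (sample R λ _ → 0) ps qs is
    (history b (weights Sᵦ) (sample R δ₀) n)))

check : ℕ → ℕ → List ℕ → List ℕ → List ℕ → Trie 18 → Bool
check n b ps qs is R = checkTries n b ps qs is R (periodᵀ (powers 1 1 R)) (periodᵀ (powers (suc b) 1 R))

-- For the denominator with coefficients `ps - qs`, `recurrence` bounds the degree of the numerator
-- by `d` and `nonzero` makes it exactly `d`.
record Certified (d : ℕ) (ps qs is : List ℕ) (f : ℕ → ℕ) : Set where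
  field
    recurrence : ∀ m → convolution ps f (suc d + m) ≡ convolution qs f (suc d + m)
    nonzero    : convolution ps f d ≢ convolution qs f d
    initial    : map f (downFrom 7) ≡ is

certify : ∀ ps qs is f → T (checkCounts ps qs is (map f (downFrom 149))) →
  (∀ m → convolution ps f (148 + m) ≡ convolution qs f (148 + m)) → Certified 146 ps qs is f
certify ps qs is f ok recurrence₁₄₈ = record
  { recurrence = λ where
      zero    → ℕ.≡ᵇ⇒≡ _ _ (proj₁ ok₂)
      (suc m) → subst (λ n → convolution ps f n ≡ convolution qs f n) (sym (ℕ.+-suc 147 m)) (recurrence₁₄₈ m)
  ; nonzero    = λ eq → contradiction
      (trans (sym (Equivalence.to T-not-≡ (proj₂ ok₂))) (Equivalence.to T-≡ (ℕ.≡⇒≡ᵇ _ _ eq))) λ ()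
  ; initial    = listEq⇒≡ _ _ (proj₁ ok₁)
  }
  where
  ok₁ = ∧-split {listEq (map f (downFrom 7)) is} ok
  ok₂ = ∧-split {convolution ps f 147 ≡ᵇ convolution qs f 147} (proj₂ ok₁)

module Recurrence (b : ℕ) (R : Trie 18)
  (shape₁ : T (sameShape (periodᵀ (powers 1 1 R)) R))
  (shapeᵦ : T (sameShape (periodᵀ (powers (suc b) 1 R)) R))
  (starts : T (startsBlank R)) where

  open Closed b R shape₁ shapeᵦ

  zeros : List ℕ
  zeros = sample R λ _ → 0

  past : ℕ → List (List ℕ)
  past = history b (weights (periodᵀ (powers (suc b) 1 R))) (sample R δ₀)

  f : ℕ → ℕ
  f j = count j blank

  heads-samples : ∀ n → heads (samples n) ≡ map f (downFrom (suc n))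
  heads-samples n = trans (sym (map-∘ (downFrom (suc n)))) (map-cong (λ j → first (count j)) (downFrom (suc n)))
    where
    first : ∀ g → fromMaybe 0 (head (sample R g)) ≡ g blank
    first g with _ , eq ← startsBlank⇒ R starts g = cong (fromMaybe 0 ∘ head) eq

  past-verified : ∀ n ps qs is → T (allBelow b (weights (periodᵀ (powers 1 1 R))) (past n)) →
    T (listEq (combine zeros ps (past n)) (combine zeros qs (past n)) ∧ checkCounts ps qs is (heads (past n))) →
    T (listEq (combine zeros ps (samples n)) (combine zeros qs (samples n))) ×
    T (checkCounts ps qs is (map f (downFrom (suc n))))
  past-verified n ps qs is below ok =
    subst (λ as → T (listEq (combine zeros ps (samples n)) (combine zeros qs (samples n))) × T (checkCounts ps qs is as))
      (heads-samples n)
      (∧-split (subst (λ vss → T (listEq (combine zeros ps vss) (combine zeros qs vss) ∧ checkCounts ps qs is (heads vss)))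
        (history≡samples n below) ok))

  -- By linearity each convolution at `n + m` is the value at the empty window of `m` periods
  -- applied to a combination of `count n`, ..., `count 0`. The two combinations agree on `R`, so
  -- `agreement` applies.
  persists : ∀ n ps qs → length ps ≤ suc n → length qs ≤ suc n →
    T (listEq (combine zeros ps (samples n)) (combine zeros qs (samples n))) →
    ∀ m → convolution ps f (n + m) ≡ convolution qs f (n + m)
  persists n ps qs ps≤ qs≤ ok m = trans (shifted ps ps≤)
    (trans (agreement starts
             (trans (sym (combine-samples ps n)) (trans (listEq⇒≡ _ _ ok) (combine-samples qs n))) m)
           (sym (shifted qs qs≤)))
    where
    shifted : ∀ cs → length cs ≤ suc n → convolution cs f (n + m) ≡
      columnSteps (8 * m) (λ w → dot cs (map (λ j → count j w) (downFrom (suc n)))) blank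
    shifted cs len = begin
      dot cs (map f (downFrom (suc (n + m))))
        ≡⟨ cong (λ k → dot cs (map f (downFrom k))) (trans (cong suc (ℕ.+-comm n m)) (sym (ℕ.+-suc m n))) ⟩
      dot cs (map f (downFrom (m + suc n)))
        ≡⟨ dot-downFrom-+ cs f m (suc n) len ⟩
      dot cs (map (λ j → f (m + j)) (downFrom (suc n)))
        ≡⟨ cong (dot cs) (map-cong (λ j → cong (_$ blank) (sym (count-+ m j))) (downFrom (suc n))) ⟩
      dot cs (map (λ j → columnSteps (8 * m) (count j) blank) (downFrom (suc n)))
        ≡⟨ sym (columnSteps-dot (8 * m) cs count (downFrom (suc n)) blank) ⟩
      columnSteps (8 * m) (λ w → dot cs (map (λ j → count j w) (downFrom (suc n)))) blank ∎
      where open ≡-Reasoning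

-- All parameters are variables here, so no trie is computed; that is left to `verified`.
check-sound : ∀ n b ps qs is R → length ps ≤ suc n → length qs ≤ suc n → T (check n b ps qs is R) →
  T (checkCounts ps qs is (map (λ j → count j blank) (downFrom (suc n)))) ×
  (∀ m → convolution ps (λ j → count j blank) (n + m) ≡ convolution qs (λ j → count j blank) (n + m))
check-sound n b ps qs is R ps≤ qs≤ ok = proj₂ ok₅ , persists n ps qs ps≤ qs≤ (proj₁ ok₅)
  where
  S₁ = periodᵀ (powers 1 1 R)
  ok₁ = ∧-split {startsBlank R} ok
  ok₂ = ∧-split {sameShape S₁ R} (proj₂ ok₁)
  ok₃ = ∧-split {sameShape (periodᵀ (powers (suc b) 1 R)) R} (proj₂ ok₂)
  open Recurrence b R (proj₁ ok₂) (proj₁ ok₃) (proj₁ ok₁)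
  ok₄ = ∧-split {allBelow b (weights S₁) (past n)} (proj₂ ok₃)
  ok₅ = past-verified n ps qs is (proj₁ ok₄) (proj₂ ok₄)

-- Rational generating functions

ι : ℤ → ℚ
ι i = i ℚ./ 1

toℚᵘ-ι : ∀ i → toℚᵘ (ι i) ℚᵘ.≃ mkℚᵘ i 0
toℚᵘ-ι i = ℚ.toℚᵘ-fromℚᵘ (mkℚᵘ i 0)

-- Transferred to unnormalised rationals, where the sum of integers is not obscured by reduction to
-- lowest terms.
ι-+ : ∀ i j → ι (i +ℤ j) ≡ ι i ℚ.+ ι j
ι-+ i j = ℚ.toℚᵘ-injective (begin
  toℚᵘ (ι (i +ℤ j))              ≈⟨ toℚᵘ-ι (i +ℤ j) ⟩
  mkℚᵘ (i +ℤ j) 0                ≈⟨ *≡* (cong (_*ℤ + 1) (sym (cong₂ _+ℤ_ (ℤ.*-identityʳ i) (ℤ.*-identityʳ j)))) ⟩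
  mkℚᵘ i 0 ℚᵘ.+ mkℚᵘ j 0         ≈⟨ ℚᵘ.+-cong (ℚᵘ.≃-sym (toℚᵘ-ι i)) (ℚᵘ.≃-sym (toℚᵘ-ι j)) ⟩
  toℚᵘ (ι i) ℚᵘ.+ toℚᵘ (ι j)     ≈⟨ ℚᵘ.≃-sym (ℚ.toℚᵘ-homo-+ (ι i) (ι j)) ⟩
  toℚᵘ (ι i ℚ.+ ι j)             ∎)
  where open import Relation.Binary.Reasoning.Setoid ℚᵘ.≃-setoid

ι-* : ∀ i j → ι (i *ℤ j) ≡ ι i ℚ.* ι j
ι-* i j = ℚ.toℚᵘ-injective (begin
  toℚᵘ (ι (i *ℤ j))              ≈⟨ toℚᵘ-ι (i *ℤ j) ⟩
  mkℚᵘ i 0 ℚᵘ.* mkℚᵘ j 0         ≈⟨ ℚᵘ.*-cong (ℚᵘ.≃-sym (toℚᵘ-ι i)) (ℚᵘ.≃-sym (toℚᵘ-ι j)) ⟩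
  toℚᵘ (ι i) ℚᵘ.* toℚᵘ (ι j)     ≈⟨ ℚᵘ.≃-sym (ℚ.toℚᵘ-homo-* (ι i) (ι j)) ⟩
  toℚᵘ (ι i ℚ.* ι j)             ∎)
  where open import Relation.Binary.Reasoning.Setoid ℚᵘ.≃-setoid

ι-injective : ∀ {i} → ι i ≡ 0ℚ → i ≡ 0ℤ
ι-injective {i} eq with *≡* p ← ℚ./-injective-≃ (mkℚᵘ i 0) (mkℚᵘ 0ℤ 0) eq = trans (sym (ℤ.*-identityʳ i)) p

coefficient : List ℤ → ℕ → ℤ
coefficient []       _       = 0ℤ
coefficient (c ∷ cs) zero    = c
coefficient (c ∷ cs) (suc i) = coefficient cs i

coefficient-beyond : ∀ cs i → length cs ≤ i → coefficient cs i ≡ 0ℤ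
coefficient-beyond []       i       _         = refl
coefficient-beyond (c ∷ cs) (suc i) (s≤s len) = coefficient-beyond cs i len

-- Splitting each coefficient by sign turns the signed recurrence into an equality of two sums in
-- `ℕ`, where samples and pairings live.
positive negative : ℤ → ℕ
positive (+ n)      = n
positive -[1+ n ]   = 0
negative (+ n)      = 0
negative -[1+ n ]   = suc n

positive⊖negative : ∀ c n → c *ℤ + n ≡ positive c * n ⊖ negative c * n
positive⊖negative (+ k)    n = sym (ℤ.pos-* k n)
positive⊖negative -[1+ k ] n = trans (sym (ℤ.neg-distribˡ-* (+ suc k) (+ n)))
  (trans (cong -ℤ_ (sym (ℤ.pos-* (suc k) n))) (sym (ℤ.⊖-≤ z≤n)))

⊖-+-⊖ : ∀ m n k l → (m ⊖ n) +ℤ (k ⊖ l) ≡ (m + k) ⊖ (n + l)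
⊖-+-⊖ m n k l = begin
  (m ⊖ n) +ℤ (k ⊖ l)                          ≡⟨ cong₂ _+ℤ_ (sym (ℤ.m-n≡m⊖n m n)) (sym (ℤ.m-n≡m⊖n k l)) ⟩
  (+ m +ℤ -ℤ + n) +ℤ (+ k +ℤ -ℤ + l)          ≡⟨ ℤ-interchange (+ m) (-ℤ + n) (+ k) (-ℤ + l) ⟩
  (+ m +ℤ + k) +ℤ (-ℤ + n +ℤ -ℤ + l)          ≡⟨ cong (+ (m + k) +ℤ_) (sym (ℤ.neg-distrib-+ (+ n) (+ l))) ⟩
  + (m + k) +ℤ -ℤ + (n + l)                   ≡⟨ ℤ.m-n≡m⊖n (m + k) (n + l) ⟩
  (m + k) ⊖ (n + l)                           ∎
  where open ≡-Reasoning

polynomial : List ℤ → PowerSeries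
polynomial cs i = ι (coefficient cs i)

⊛-polynomial : ∀ cs f n → (polynomial cs ⊛ generatingFunction f) n ≡
  ι (convolution (map positive cs) f n ⊖ convolution (map negative cs) f n)
⊛-polynomial []       f n       = vanish {suc n} (λ i → generatingFunction f (n ∸ toℕ i))
  where
  vanish : ∀ {m} (g : Fin m → ℚ) → sum (λ i → ι 0ℤ ℚ.* g i) ≡ 0ℚ
  vanish {zero}  g = refl
  vanish {suc m} g = cong₂ ℚ._+_ (ℚ.*-zeroˡ (g Fin.zero)) (vanish (g ∘ Fin.suc))
⊛-polynomial (c ∷ cs) f zero    = begin
  ι c ℚ.* ι (+ f 0) ℚ.+ 0ℚ                    ≡⟨ ℚ.+-identityʳ _ ⟩
  ι c ℚ.* ι (+ f 0)                           ≡⟨ sym (ι-* c (+ f 0)) ⟩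
  ι (c *ℤ + f 0)                              ≡⟨ cong ι (positive⊖negative c (f 0)) ⟩
  ι (positive c * f 0 ⊖ negative c * f 0)     ≡⟨ cong ι (cong₂ _⊖_ (single positive) (single negative)) ⟩
  ι (convolution (map positive (c ∷ cs)) f 0 ⊖ convolution (map negative (c ∷ cs)) f 0) ∎
  where
  open ≡-Reasoning
  dot-[] : ∀ cs → dot cs [] ≡ 0
  dot-[] []      = refl
  dot-[] (_ ∷ _) = refl
  single : ∀ (part : ℤ → ℕ) → part c * f 0 ≡ convolution (map part (c ∷ cs)) f 0
  single part = sym (trans (cong (λ x → part c * f 0 + x) (dot-[] (map part cs))) (ℕ.+-identityʳ _))
⊛-polynomial (c ∷ cs) f (suc n) = begin
  -- Splitting off the first term shifts both indices by one, so the rest of the sum is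
  -- definitionally the product for `cs` at `n`.
  ι c ℚ.* ι (+ f (suc n)) ℚ.+ (polynomial cs ⊛ generatingFunction f) n
    ≡⟨ cong₂ ℚ._+_ (sym (ι-* c (+ f (suc n)))) (⊛-polynomial cs f n) ⟩
  ι (c *ℤ + f (suc n)) ℚ.+ ι (P ⊖ Q)
    ≡⟨ sym (ι-+ (c *ℤ + f (suc n)) (P ⊖ Q)) ⟩
  ι (c *ℤ + f (suc n) +ℤ (P ⊖ Q))
    ≡⟨ cong ι (trans (cong (_+ℤ (P ⊖ Q)) (positive⊖negative c (f (suc n))))
        (⊖-+-⊖ (positive c * f (suc n)) (negative c * f (suc n)) P Q)) ⟩
  ι (convolution (map positive (c ∷ cs)) f (suc n) ⊖ convolution (map negative (c ∷ cs)) f (suc n)) ∎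
  where
  open ≡-Reasoning
  P = convolution (map positive cs) f n
  Q = convolution (map negative cs) f n

-- Found by the Berlekamp–Massey algorithm.
denominator : List ℤ
denominator =
    + 1 ∷ -ℤ + 464 ∷ + 17927 ∷ + 755130 ∷ -ℤ + 95768304 ∷ + 1285271552 ∷ + 58159770494 ∷ -ℤ + 5150358034406 ∷
    + 50432249866524 ∷ + 6534000436922452 ∷ + 17089987441385604 ∷ -ℤ + 4930746229630332770 ∷
    -ℤ + 9991080253201205931 ∷ + 1563513575724272470980 ∷ + 5968281730275659359290 ∷
    + 549458828057968672720512 ∷ + 11139378106334541314893791 ∷ + 112510135310738059717869486 ∷
    -ℤ + 317715065836560104802002958 ∷ -ℤ + 5043469531689275904344222772 ∷
    -ℤ + 102256892899327181021713436503 ∷ -ℤ + 2981975174685181906046885289980 ∷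
    -ℤ + 89801436995174337478328153882026 ∷ -ℤ + 1608176502192475904267424097111924 ∷
    -ℤ + 13601766277434006310946532545564664 ∷ -ℤ + 34482771956939603851956465337113466 ∷
    + 463296458011419002253482599236041540 ∷ + 4280242583886725905867607644316440476 ∷
    -ℤ + 2642057341830765416392395150729559773 ∷ -ℤ + 236503727894768494996207088162552785108 ∷
    -ℤ + 902949949812236030302156112949492009487 ∷ + 4021889390007158931495092966285950351756 ∷
    + 64994550401685038362400426615706554030109 ∷ + 500658710058311560091436471309842714256676 ∷
    + 1926082379850983460222667002830845108695266 ∷ -ℤ + 9752315180296728218973002005470038658295658 ∷
    -ℤ + 110992711732130233021137198472937513744570040 ∷ + 44460504322600711077227559315697481134720948 ∷
    + 3616418702464001791152712141046707090227465982 ∷ + 7618288870633616413006789670947803346063320130 ∷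
    -ℤ + 45372396487777794453135724271580606552709706877 ∷
    -ℤ + 151157546640024095650791376335796085125619596390 ∷
    -ℤ + 552690833160805684328748441140764507389949897213 ∷
    -ℤ + 5454038149480719141330808399596446484183957284616 ∷
    -ℤ + 46462897970613110606960545507297003881423619436485 ∷
    -ℤ + 286922630882484550445281613680738207095398249118452 ∷
    -ℤ + 1034792121390124483650098127207183641500633427128646 ∷
    -ℤ + 1951690117287876936544492551080051512686041934797040 ∷
    -ℤ + 442969198501389998775079906362205104181418724306573 ∷
    + 3346006695968822377575884622851760283115060056104864 ∷
    -ℤ + 35130961872355739291145928555382555054751455547592381 ∷
    -ℤ + 147893734488376536452867568187116467225812662347847912 ∷
    -ℤ + 9029978957584341296289550192715949481993515466397721 ∷
    + 518765747536452930206417959981679914288224853531504598 ∷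
    + 522064590197214802686264688597813256050593336735204872 ∷
    -ℤ + 1158637747827131473728173618237199804256857996003490820 ∷
    -ℤ + 10800940537345327806267408897220641835038512602357964405 ∷
    -ℤ + 16324542641555423664519601969248506584665639950579275762 ∷
    + 18151550789568890232578538893422078604650592122231213960 ∷
    + 3337066043625378321805718691897456621699847554571217194 ∷
    + 17576254766648770690838479262222596465136794918752474444 ∷
    + 265940931915122176737762407610713012309051091226650242280 ∷
    + 203465043704687196268049200759773293746664887564520707877 ∷
    -ℤ + 621202908232331099172632775604023701144660728626607809260 ∷
    -ℤ + 1978564722939290278044940124302516839662459620223188661723 ∷
    -ℤ + 4373061260737895887642910773357336723981070312148955639862 ∷
    + 2172575528061688662568478602662696441923973921473428135719 ∷
    + 13263373515061595134556253053158046776379047146978974089294 ∷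
    + 9805998676430104525556433945228273007277702428448815386058 ∷
    + 21205892973785297568066956108660478338768914565470604204532 ∷
    + 69709936715654893256445328080112731029848358722291811583855 ∷
    + 129274718208129679301487235097035865871445962479580777656654 ∷
    + 190420917933579436529902471559338295220261887099265114310787 ∷
    + 178407567052063550048543134242217637544830404048179403506484 ∷
    + 24784063448792786167876291610696056735042839364176211666720 ∷
    + 149029361599507207927429003689815789137070228971699136157198 ∷
    + 373029527596719430445335126741559284043498925408532065018863 ∷
    + 405658667171071244196946884362002108387771903168621068620658 ∷
    + 211505884187949884882683945712376204027173082477545432443801 ∷
    -ℤ + 32833154245461330587706864583777076457127065905322227699586 ∷
    -ℤ + 66746199883257092944988018986400899836724366157471210656451 ∷
    -ℤ + 108108156204519264916874755579055537685375960125678952943084 ∷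
    -ℤ + 12759713195103270751165747241936105608849068657406890682708 ∷
    -ℤ + 97981188993320473034908529487453474142940907811155935173704 ∷
    -ℤ + 73380372362052863003599930892704415062317447740672123824098 ∷
    + 166092199005115772247469961075891291792427631353006417831996 ∷
    + 109146309867507054519919528207429917142464643338038920768768 ∷
    + 64702159287591878927081615698669471124610657036397339467076 ∷
    + 72747321717115953428720662601877454007506183762596353490629 ∷
    + 37130974682377814239333525521500435349482622318122090261340 ∷
    + 138512926475748029754830193462336528897433770658472882978339 ∷
    + 175384991391907800726334370151673219956147134133339666584570 ∷
    + 104834182935998671812367609372860623098538834942907584090094 ∷
    + 70713626072631346894913769217900840606077758757924425326962 ∷
    + 31437162574279665529620220704580136512700514275181052422908 ∷
    + 8066207543888915958552780025082654675843747985263910849078 ∷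
    + 20118716480625342415424044298728778084339011673698128174472 ∷
    + 14352461467798901796377377240891842652644947870234117644158 ∷
    + 9664850736446188538515060470492720273855777834923146159705 ∷
    + 8271740800846174762472980026274473994456592306561589456386 ∷
    + 2843111350083174563352974430824927730640754695584275296407 ∷
    + 739960444809111829329275282842295349718135884751359536874 ∷
    + 356891047568393765627119806098429430802799109969652286994 ∷
    -ℤ + 174921940433610750639695614428381507004254510403697021064 ∷
    -ℤ + 87116542650545723375773699016506260354005119203372241432 ∷
    -ℤ + 68937234588510657531067689989583459030491459541326420858 ∷
    -ℤ + 93059847990661586429322662126892284597172065223087395675 ∷
    -ℤ + 47367797927672616375806003073575485544002758051052682092 ∷
    -ℤ + 26617280776428711791798098173464220085853475685603745293 ∷
    -ℤ + 16252248222327640820841740401438247007882183795055849186 ∷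
    -ℤ + 6927712705197093294805850945279430035463572639292565648 ∷
    -ℤ + 2641224679396425289665514528122449094098251212232438032 ∷
    -ℤ + 1067941362844885420337338472911070040804040795018619252 ∷
    -ℤ + 409771031203645310606864801094359520934173806030752570 ∷
    -ℤ + 113060539939836830888481247786527786676249996493603180 ∷
    -ℤ + 28570087080151216784897482599798307862796053136313312 ∷
    -ℤ + 10190844551240630604584445734304044781407285918509885 ∷
    -ℤ + 1986934193743233414900996140914717021818730019059958 ∷
    -ℤ + 504155115988959896187788201062021456664612493061496 ∷
    -ℤ + 132918569090567738167262242938673321445929006292252 ∷
    -ℤ + 56403471663002862267260259135595450485909104221064 ∷
    -ℤ + 3956323442705303845340975987782141448383099703588 ∷
    + 3567375754957603655046841988925932144998621018408 ∷
    -ℤ + 151714002631144720609845083104725206925706741958 ∷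
    + 330305431873280795845573710050929643261311828672 ∷ + 42843168384910877887074056781949904768554140996 ∷
    -ℤ + 17310761706673865986888081282553145166353580444 ∷
    -ℤ + 2804475616206698475880490067020700265172319644 ∷ + 178269687554545639665077913776953742799494492 ∷
    -ℤ + 228807760173687302504168243915863133688566874 ∷ + 8084505685671445521089171164629179557900527 ∷
    + 11204594179583096820446424525188103206847636 ∷ -ℤ + 1172933335957198959200935720127578693771928 ∷
    -ℤ + 136070749185604983573205094588213598242992 ∷ + 40854200436267924695813140019080130223311 ∷
    -ℤ + 2378718502128568477574034789845307280630 ∷ -ℤ + 302191408073593744657034109449598890031 ∷
    + 48659584874229292576952571022165053608 ∷ -ℤ + 1317575068298454475926174037608752605 ∷
    -ℤ + 182979091068025746821002368177956832 ∷ + 10673759289027051579942622149327497 ∷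
    + 396146141904059552570079913472234 ∷ -ℤ + 18256438051447706341118180592377 ∷
    -ℤ + 3257387309578638670833877747792 ∷ + 237154434818577945447310400107 ∷
    -ℤ + 2678791034671781067837888332 ∷ + 24419385703774311492193976 ∷ []

initialTerms : List ℕ
initialTerms = 1267783654718834 ∷ 3032714594518 ∷ 7258193991 ∷ 17416144 ∷ 42305 ∷ 114 ∷ 1 ∷ []

-- Evaluation of the certificate and conclusion

opaque
  unfolding cellStepsᵀ

  -- The base has to exceed the sum of f 149 over the windows of R.
  verified : check 148 (2 ^ 1320 ∸ 1) (map positive denominator) (map negative denominator) initialTerms
               (periodᵀ (periodᵀ (only blank))) ≡ true
  verified = refl

certified : Certified 146 (map positive denominator) (map negative denominator) initialTerms λ j → count j blank
certified = certify _ _ _ _ (proj₁ facts) (proj₂ facts)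
  where
  facts = check-sound 148 (2 ^ 1320 ∸ 1) (map positive denominator) (map negative denominator) initialTerms
    -- The set `R` is read off from the shape of this trie: the windows reachable from the empty one
    -- after two periods.
    (periodᵀ (periodᵀ (only blank)))
    (from-yes (length (map positive denominator) ≤? 149)) (from-yes (length (map negative denominator) ≤? 149))
    (Equivalence.from T-≡ verified)

⊖-≡0 : ∀ {m n} → m ⊖ n ≡ 0ℤ → m ≡ n
⊖-≡0 {m} {n} eq = ℤ.+-injective (ℤ.i-j≡0⇒i≡j (+ m) (+ n) (trans (ℤ.m-n≡m⊖n m n) eq))

rational : ∀ d cs f → length cs ≡ suc d → coefficient cs 0 ≢ 0ℤ → coefficient cs d ≢ 0ℤ →
  (∀ m → convolution (map positive cs) f (suc d + m) ≡ convolution (map negative cs) f (suc d + m)) →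
  convolution (map positive cs) f d ≢ convolution (map negative cs) f d →
  ∃[ A ] ∃[ B ] HasDegree A d × HasDegree B d × generatingFunction f IsQuotientOf neg A By B
rational d cs f len c₀≢0 c-d≢0 recurrence nonzero =
    -- The quotient requires `neg A` to be the product `BF`, hence the sign. `recurrence` makes `A`
    -- vanish above `d`, and `nonzero` gives its leading coefficient.
    neg BF , B
  , ( (λ eq → nonzero (⊖-≡0 (ι-injective (trans (sym (BF≡ d))
        (trans (sym (⁻¹-involutive (BF d))) (cong ℚ.-_ eq))))))
    , λ i d<i → cong ℚ.-_ (vanishes i d<i))
  , ( c-d≢0 ∘ ι-injective
    , λ i d<i → cong ι (coefficient-beyond cs i (subst (_≤ i) (sym len) d<i)))
  , c₀≢0 ∘ ι-injective
  , λ n → sym (⁻¹-involutive (BF n))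
  where
  B BF : PowerSeries
  B = polynomial cs
  BF = B ⊛ generatingFunction f
  BF≡ : ∀ n → BF n ≡ ι (convolution (map positive cs) f n ⊖ convolution (map negative cs) f n)
  BF≡ = ⊛-polynomial cs f
  vanishes : ∀ i → d < i → BF i ≡ 0ℚ
  vanishes i d<i with m , refl ← ℕ.m≤n⇒∃[o]m+o≡n d<i = trans (BF≡ (suc d + m))
    (cong ι (trans (cong (_⊖ convolution (map negative cs) f (suc d + m)) (recurrence m))
                   (ℤ.n⊖n≡0 (convolution (map negative cs) f (suc d + m)))))

certified-cong : ∀ {d ps qs is f g} → (∀ j → f j ≡ g j) → Certified d ps qs is f → Certified d ps qs is g
certified-cong {d} {ps} {qs} f≡g cert = record
  { recurrence = λ m → trans (sym (convolution-cong ps (suc d + m) f≡g))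
      (trans (Certified.recurrence cert m) (convolution-cong qs (suc d + m) f≡g))
  ; nonzero = λ eq → Certified.nonzero cert (trans (convolution-cong ps d f≡g)
      (trans eq (sym (convolution-cong qs d f≡g))))
  ; initial = trans (sym (map-cong f≡g (downFrom 7))) (Certified.initial cert)
  }

-- Stated for a variable `f`, so that extracting the initial values does not evaluate `numTilings`.
certified⇒ : ∀ d cs f → length cs ≡ suc d → coefficient cs 0 ≢ 0ℤ → coefficient cs d ≢ 0ℤ →
  Certified d (map positive cs) (map negative cs) initialTerms f →
  (∃[ A ] ∃[ B ] HasDegree A d × HasDegree B d × generatingFunction f IsQuotientOf neg A By B)
  × f 0 ≡ 1 × f 1 ≡ 114 × f 2 ≡ 42305 × f 3 ≡ 17416144 × f 4 ≡ 7258193991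
  × f 5 ≡ 3032714594518 × f 6 ≡ 1267783654718834
certified⇒ d cs f len c₀≢0 c-d≢0 cert
  with f₆ , t ← ∷-injective (Certified.initial cert)
  with f₅ , t ← ∷-injective t
  with f₄ , t ← ∷-injective t
  with f₃ , t ← ∷-injective t
  with f₂ , t ← ∷-injective t
  with f₁ , t ← ∷-injective t
  with f₀ , _ ← ∷-injective t
  = rational d cs f len c₀≢0 c-d≢0 (Certified.recurrence cert) (Certified.nonzero cert)
  , f₀ , f₁ , f₂ , f₃ , f₄ , f₅ , f₆

proposition10 :
  let a : ℕ → ℕ
      a n = numTilings 9 (8 * n)
  in (∃[ A ] ∃[ B ] HasDegree A 146 × HasDegree B 146
        × generatingFunction a IsQuotientOf neg A By B)
     × a 0 ≡ 1
     × a 1 ≡ 114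
     × a 2 ≡ 42305
     × a 3 ≡ 17416144
     × a 4 ≡ 7258193991
     × a 5 ≡ 3032714594518
     × a 6 ≡ 1267783654718834
proposition10 = certified⇒ 146 denominator (λ n → numTilings 9 (8 * n)) refl (λ ()) (λ ())
  (certified-cong (λ n → sym (numTilings≡count n)) certified)
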